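{- Let $d\ge1$ and $k\ge1$ be integers and suppose that $G=(V,E)$ is a $k$-fold $\mathcal{R}_d$-circuit such that every $(k-1)$-fold $\mathcal{R}_d$-circuit contained in $G$ is $\mathcal{R}_d$-rigid. Then $G$ is balanced.
   Context: For a graph $G=(V,E)$ and a generic $p:V\to\mathbb{R}^d$ (coordinates algebraically independent over $\mathbb{Q}$), the rigidity matrix $R(G,p)$ has a row for each $uv\in E$ with $p(u)-p(v)$ in the $d$ columns of $u$, $p(v)-p(u)$ in those of $v$, zeros elsewhere. The generic $d$-dimensional rigidity matroid $\mathcal{R}_d$ is its row matroid (on the edge set of a complete graph containing $G$), with rank function $r_d$ and closure $\mathrm{cl}(X)=\{x: r_d(X\cup\{x\})=r_d(X)\}$. Graphs are identified with their edge sets, and an edge set is regarded as the graph it spans. A graph $H=(W,F)$ is $\mathcal{R}_d$-rigid if it is a complete graph on at most $d+1$ vertices or $r_d(F)=d|W|-\binom{d+1}{2}$. A set of edges is cyclic if it is a union of $\mathcal{R}_d$-circuits. A graph $(V,D)$ is a $k$-fold $\mathcal{R}_d$-circuit if $D$ is cyclic and $r_d(D)=|D|-k$. Its principal partition is the partition $\{A_1,\dots,A_\ell\}$ of $D$ such that $\{D\setminus A_i\}$ is exactly the set of $(k-1)$-fold $\mathcal{R}_d$-circuits contained in $D$. It is balanced if $r_d\big(\bigcap_{i=1}^\ell \mathrm{cl}(D\setminus A_i)\big)=\ell-k$. -}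

module Defs where

open import Level using (_⊔_)
open import Algebra.Apartness.Bundles using (HeytingField; HeytingCommutativeRing)
open import Algebra.Bundles using (CommutativeRing; RawRing)
open import Data.Empty using (⊥-elim)
open import Data.Fin.Base using (Fin; zero; suc; remQuot)
open import Data.Fin.Properties using (any?; _≟_) renaming (_<?_ to _<ᶠ?_)
open import Data.Fin.Subset
  using (Subset; _∈_; _∉_; _⊆_; _⊂_; ⁅_⁆; _∪_; _∩_; _─_; ⋃; ⋂; ∣_∣; Nonempty; Empty; inside; outside)
  renaming (_-_ to _∖_)
open import Data.Fin.Subset.Properties using (_∈?_; _⊆?_; nonempty?; p─q⊆p; x∈p∧x≢y⇒x∈p-y)
open import Data.List.Base as List using (List; []; _∷_; _++_; foldr; filter; cartesianProduct; allFin; length; lookup)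
open import Data.List.Extrema.Nat using (max)
open import Data.List.Relation.Unary.All using (All)
open import Data.Nat.Base as ℕ using (ℕ; zero; suc)
import Data.Nat.Properties as ℕ
open import Data.Nat.Combinatorics using (_C_)
open import Data.Product.Base using (∃; _×_; _,_; proj₁; proj₂; uncurry)
open import Data.Rational.Base using (ℚ; 0ℚ)
open import Data.Sum.Base using (_⊎_; inj₁; inj₂)
import Data.Vec.Base as Vec
open import Function.Base using (_∘_)
open import Function.Bundles using (_⇔_)
open import Relation.Binary.Definitions using (Decidable)
open import Relation.Binary.PropositionalEquality.Core as ≡ using (_≡_; _≢_)
open import Relation.Nullary using (Dec; yes; no; ¬_)
open import Relation.Nullary.Decidable using (_×-dec_; _⊎-dec_; ¬?; map′; ⌊_⌋)
import Relation.Unary as U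

private
  variable
    n : ℕ

subsets : ∀ m → List (Subset m)
subsets zero    = Vec.[] ∷ []
subsets (suc m) = List.map (outside Vec.∷_) (subsets m) ++ List.map (inside Vec.∷_) (subsets m)

module Matroid {a} {m : ℕ} (Indep : Subset m → Set a) (indep? : U.Decidable Indep) where

  rank : Subset m → ℕ
  rank X = max 0 (List.map ∣_∣ (filter (λ Y → (Y ⊆? X) ×-dec indep? Y) (subsets m)))

  cl : Subset m → Subset m
  cl X = Vec.tabulate λ x → ⌊ rank (X ∪ ⁅ x ⁆) ℕ.≟ rank X ⌋

  IsCircuit : Subset m → Set a
  IsCircuit X = ¬ Indep X × (∀ Y → Y ⊂ X → Indep Y)

  IsCyclic : Subset m → Set a
  IsCyclic X = ∃ λ Cs → All IsCircuit Cs × ⋃ Cs ≡ X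

  -- rank D = ∣D∣ - k, without truncated subtraction (likewise below)
  IsFoldCircuit : ℕ → Subset m → Set a
  IsFoldCircuit k D = IsCyclic D × rank D ℕ.+ k ≡ ∣ D ∣

  record IsPrincipalPartition (k : ℕ) (D : Subset m) {ℓ : ℕ} (A : Fin ℓ → Subset m) : Set a where
    field
      nonempty : ∀ i → Nonempty (A i)
      disjoint : ∀ i j → i ≢ j → Empty (A i ∩ A j)
      covers   : ⋃ (List.tabulate A) ≡ D
      folds    : ∀ X → (IsFoldCircuit (k ℕ.∸ 1) X × X ⊆ D) ⇔ (∃ λ i → X ≡ D ─ A i)

  -- The principal partition is determined by `folds` up to the order of its
  -- parts, so quantifying over all its enumerations amounts to choosing one.
  IsBalanced : ℕ → Subset m → Set a
  IsBalanced k D = ∀ {ℓ} (A : Fin ℓ → Subset m) → IsPrincipalPartition k D A →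
    rank (⋂ (List.tabulate λ i → cl (D ─ A i))) ℕ.+ k ≡ ℓ

-- Edges of the complete graph on Fin n are numbered by their position in
-- this list, so that edge sets are library subsets.
edges : ∀ n → List (Fin n × Fin n)
edges n = filter (λ (u , v) → u <ᶠ? v) (cartesianProduct (allFin n) (allFin n))

∣K_∣ : ℕ → ℕ
∣K n ∣ = length (edges n)

EdgeSet : ℕ → Set
EdgeSet n = Subset ∣K n ∣

ends : Fin ∣K n ∣ → Fin n × Fin n
ends {n} = lookup (edges n)

spanned : EdgeSet n → Subset n
spanned F = Vec.tabulate λ w →
  ⌊ any? (λ e → (e ∈? F) ×-dec ((w ≟ proj₁ (ends e)) ⊎-dec (w ≟ proj₂ (ends e)))) ⌋

IsComplete : Subset n → EdgeSet n → Set
IsComplete W F = ∀ e → proj₁ (ends e) ∈ W → proj₂ (ends e) ∈ W → e ∈ F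

-- A Heyting field with decidable apartness is a field in the
-- usual sense (every element is zero or invertible).
module _ {c ℓ₁ ℓ₂} (K : HeytingField c ℓ₁ ℓ₂) where
  open HeytingField K using (heytingCommutativeRing)

  ring : CommutativeRing c ℓ₁
  ring = HeytingCommutativeRing.commutativeRing heytingCommutativeRing

  rawRing : RawRing c ℓ₁
  rawRing = CommutativeRing.rawRing ring

-- ℚ[X₀, …, X_{N-1}] as ℚ[X₁, …, X_{N-1}][X₀]: lists of coefficients of
-- 1, X₀, X₀², …
Polynomial : ℕ → Set
Polynomial zero    = ℚ
Polynomial (suc N) = List (Polynomial N)

IsZero : ∀ N → Polynomial N → Set
IsZero zero    q = q ≡ 0ℚ
IsZero (suc N) f = All (IsZero N) f

module Genericity {c ℓ₁ ℓ₂} (K : HeytingField c ℓ₁ ℓ₂) (ι : ℚ → HeytingField.Carrier K) where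
  open HeytingField K using (Carrier; _≈_; _+_; _*_; 0#)

  eval : ∀ N → Polynomial N → (Fin N → Carrier) → Carrier
  eval zero    q x = ι q
  eval (suc N) f x = foldr (λ a b → eval N a (x ∘ suc) + x zero * b) 0# f

  AlgebraicallyIndependent : ∀ {N} → (Fin N → Carrier) → Set ℓ₁
  AlgebraicallyIndependent {N} x = ∀ f → eval N f x ≈ 0# → IsZero N f

  Generic : ∀ {n d} → (Fin n → Fin d → Carrier) → Set ℓ₁
  Generic {n} {d} p = AlgebraicallyIndependent (λ j → uncurry p (remQuot {n} d j))

module LinearAlgebra {c ℓ₁ ℓ₂} (K : HeytingField c ℓ₁ ℓ₂)
                     (_#?_ : Decidable (HeytingField._#_ K)) where
  open HeytingField K hiding (setoid; zero)
  open CommutativeRing (ring K) using (semiring; setoid; +-monoid)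
  open import Algebra.Properties.Semiring.Sum semiring
    using (sum; sum-cong-≋; ∑-distrib-+; *-distribˡ-sum; sum-replicate-zero)
  open import Algebra.Properties.Ring (CommutativeRing.ring (ring K))
    using (-‿distribˡ-*; -‿distribʳ-*; -0#≈0#)
  open import Relation.Binary.Reasoning.Setoid setoid

  Matrix : ℕ → ℕ → Set c
  Matrix m N = Fin m → Fin N → Carrier

  -- Coefficients on the rows in Y are coefficients on all rows vanishing off Y.
  RowsIndependent : ∀ {m N} → Matrix m N → Subset m → Set (c ⊔ ℓ₁)
  RowsIndependent {m} M Y = (a : Fin m → Carrier) → (∀ e → e ∉ Y → a e ≈ 0#) →
    (∀ j → sum (λ e → a e * M e j) ≈ 0#) → ∀ e → a e ≈ 0#

  -- The rest of the module decides RowsIndependent by Gaussian elimination;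
  -- it is needed only for `rank` to be a function.

  _≈0? : ∀ x → Dec (x ≈ 0#)
  x ≈0? with x #? 0#
  ... | yes x#0 = no λ x≈0 → proj₂ (tight x 0#) x≈0 x#0
  ... | no ¬x#0 = yes (proj₁ (tight x 0#) ¬x#0)

  inverse : ∀ {x} → ¬ x ≈ 0# → ∃ λ y → y * x ≈ 1#
  inverse {x} x≉0 with x #? 0#
  ... | no ¬x#0 = ⊥-elim (x≉0 (proj₁ (tight x 0#) ¬x#0))
  ... | yes x#0 with #⇒invertible x#0
  ...   | y , yx , _ = y , trans (*-congˡ x≈x-0) yx
    where
    x≈x-0 : x ≈ x - 0#
    x≈x-0 = sym (trans (+-congˡ -0#≈0#) (+-identityʳ x))

  sum-≈0 : ∀ {m} (t : Fin m → Carrier) → (∀ e → t e ≈ 0#) → sum t ≈ 0#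
  sum-≈0 {m} t z = trans (sum-cong-≋ {m} z) (sum-replicate-zero m)

  δ : ∀ {m} → Fin m → Fin m → Carrier
  δ zero    zero    = 1#
  δ zero    (suc _) = 0#
  δ (suc _) zero    = 0#
  δ (suc e) (suc f) = δ e f

  δ-≡ : ∀ {m} (e : Fin m) → δ e e ≈ 1#
  δ-≡ zero    = refl
  δ-≡ (suc e) = δ-≡ e

  δ-≢ : ∀ {m} (e f : Fin m) → f ≢ e → δ e f ≈ 0#
  δ-≢ zero    zero    f≢e = ⊥-elim (f≢e ≡.refl)
  δ-≢ zero    (suc f) f≢e = refl
  δ-≢ (suc e) zero    f≢e = refl
  δ-≢ (suc e) (suc f) f≢e = δ-≢ e f (f≢e ∘ ≡.cong suc)

  sum-δ : ∀ {m} (e : Fin m) (t : Fin m → Carrier) → sum (λ f → δ e f * t f) ≈ t e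
  sum-δ {suc m} zero t = begin
    1# * t zero + sum (λ f → 0# * t (suc f)) ≈⟨ +-cong (*-identityˡ _) (sum-≈0 {m} _ (λ f → zeroˡ (t (suc f)))) ⟩
    t zero + 0#                              ≈⟨ +-identityʳ _ ⟩
    t zero                                   ∎
  sum-δ (suc e) t = begin
    0# * t zero + sum (λ f → δ e f * t (suc f)) ≈⟨ +-cong (zeroˡ _) (sum-δ e (t ∘ suc)) ⟩
    0# + t (suc e)                              ≈⟨ +-identityˡ _ ⟩
    t (suc e)                                   ∎

  -- Σ (a + s δₑ) t = Σ a t + s tₑ
  sum-shift : ∀ {m} (e : Fin m) s (a t : Fin m → Carrier) →
    sum (λ f → (a f + s * δ e f) * t f) ≈ sum (λ f → a f * t f) + s * t e
  sum-shift {m} e s a t = begin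
    sum (λ f → (a f + s * δ e f) * t f)
      ≈⟨ sum-cong-≋ {m} (λ f → trans (distribʳ _ _ _) (+-congˡ (*-assoc _ _ _))) ⟩
    sum (λ f → a f * t f + s * (δ e f * t f))
      ≈⟨ ∑-distrib-+ (λ f → a f * t f) (λ f → s * (δ e f * t f)) ⟩
    sum (λ f → a f * t f) + sum (λ f → s * (δ e f * t f))
      ≈⟨ +-congˡ (sym (*-distribˡ-sum s (λ f → δ e f * t f))) ⟩
    sum (λ f → a f * t f) + s * sum (λ f → δ e f * t f)
      ≈⟨ +-congˡ (*-congˡ (sum-δ e t)) ⟩
    sum (λ f → a f * t f) + s * t e ∎

  x∉p-x : ∀ {m} (p : Subset m) e → e ∉ p ∖ e
  x∉p-x (_ Vec.∷ p) zero    ()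
  x∉p-x (_ Vec.∷ p) (suc e) (Vec.there e∈) = x∉p-x p e e∈

  module Pivot {m N} (M : Matrix m (suc N)) (Y : Subset m) (e : Fin m) (e∈Y : e ∈ Y)
               (y : Carrier) (y-inv : y * M e zero ≈ 1#) where

    -- clear column 0 using row e
    M⁰ : Matrix m (suc N)
    M⁰ f j = M f j + - (M f zero * y) * M e j

    M′ : Matrix m N
    M′ f j = M⁰ f (suc j)

    column0 : ∀ f → M⁰ f zero ≈ 0#
    column0 f = begin
      M f zero + - (M f zero * y) * M e zero   ≈⟨ +-congˡ (sym (-‿distribˡ-* _ _)) ⟩
      M f zero + - (M f zero * y * M e zero)   ≈⟨ +-congˡ (-‿cong (trans (*-assoc _ _ _) (*-congˡ y-inv))) ⟩
      M f zero + - (M f zero * 1#)             ≈⟨ +-congˡ (-‿cong (*-identityʳ _)) ⟩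
      M f zero + - M f zero                    ≈⟨ -‿inverseʳ _ ⟩
      0#                                       ∎

    row-e : ∀ j → M⁰ e j ≈ 0#
    row-e j = begin
      M e j + - (M e zero * y) * M e j ≈⟨ +-congˡ (*-congʳ (-‿cong (trans (*-comm _ _) y-inv))) ⟩
      M e j + - 1# * M e j             ≈⟨ +-congˡ (sym (-‿distribˡ-* _ _)) ⟩
      M e j + - (1# * M e j)           ≈⟨ +-congˡ (-‿cong (*-identityˡ _)) ⟩
      M e j + - M e j                  ≈⟨ -‿inverseʳ _ ⟩
      0#                               ∎

    -- Σ a M⁰ⱼ = Σ a Mⱼ - (y Σ a M₀) Mₑⱼ
    s : (Fin m → Carrier) → Carrier
    s a = - (y * sum (λ f → a f * M f zero))

    sum-M⁰ : ∀ a j → sum (λ f → a f * M⁰ f j) ≈ sum (λ f → a f * M f j) + s a * M e j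
    sum-M⁰ a j = begin
      sum (λ f → a f * M⁰ f j)
        ≈⟨ sum-cong-≋ {m} (λ f → trans (distribˡ _ _ _) (+-congˡ (term f))) ⟩
      sum (λ f → a f * M f j + (- (y * M e j)) * (a f * M f zero))
        ≈⟨ ∑-distrib-+ (λ f → a f * M f j) (λ f → (- (y * M e j)) * (a f * M f zero)) ⟩
      S + sum (λ f → (- (y * M e j)) * (a f * M f zero))
        ≈⟨ +-congˡ (sym (*-distribˡ-sum (- (y * M e j)) (λ f → a f * M f zero))) ⟩
      S + (- (y * M e j)) * S₀
        ≈⟨ +-congˡ rearrange ⟩
      S + s a * M e j ∎
      where
      S = sum (λ f → a f * M f j)
      S₀ = sum (λ f → a f * M f zero)
      rearrange : (- (y * M e j)) * S₀ ≈ s a * M e j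
      rearrange = begin
        - (y * M e j) * S₀   ≈⟨ sym (-‿distribˡ-* _ _) ⟩
        - (y * M e j * S₀)   ≈⟨ -‿cong (trans (*-assoc _ _ _) (trans (*-congˡ (*-comm _ _)) (sym (*-assoc _ _ _)))) ⟩
        - (y * S₀ * M e j)   ≈⟨ -‿distribˡ-* _ _ ⟩
        s a * M e j          ∎
      term : ∀ f → a f * (- (M f zero * y) * M e j) ≈ (- (y * M e j)) * (a f * M f zero)
      term f = begin
        a f * (- (M f zero * y) * M e j)   ≈⟨ *-congˡ (sym (-‿distribˡ-* _ _)) ⟩
        a f * - (M f zero * y * M e j)     ≈⟨ sym (-‿distribʳ-* _ _) ⟩
        - (a f * (M f zero * y * M e j))   ≈⟨ -‿cong (*-congˡ (*-assoc _ _ _)) ⟩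
        - (a f * (M f zero * (y * M e j))) ≈⟨ -‿cong (sym (*-assoc _ _ _)) ⟩
        - (a f * M f zero * (y * M e j))   ≈⟨ -‿cong (*-comm _ _) ⟩
        - (y * M e j * (a f * M f zero))   ≈⟨ -‿distribˡ-* _ _ ⟩
        (- (y * M e j)) * (a f * M f zero) ∎

    to : RowsIndependent M′ (Y ∖ e) → RowsIndependent M Y
    to ind a supp zero-sums = vanish
      where
      b : Fin m → Carrier
      b f = a f + (- a e) * δ e f

      b-e : b e ≈ 0#
      b-e = trans (+-congˡ (trans (*-congˡ (δ-≡ e)) (*-identityʳ _))) (-‿inverseʳ _)

      b-≢ : ∀ f → f ≢ e → b f ≈ a f
      b-≢ f f≢e = trans (+-congˡ (trans (*-congˡ (δ-≢ e f f≢e)) (zeroʳ _))) (+-identityʳ _)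

      b-supp : ∀ f → f ∉ Y ∖ e → b f ≈ 0#
      b-supp f f∉ with f ≟ e
      ... | yes ≡.refl = b-e
      ... | no f≢e = trans (b-≢ f f≢e) (supp f λ f∈Y → f∉ (x∈p∧x≢y⇒x∈p-y f∈Y f≢e))

      sa≈0 : s a ≈ 0#
      sa≈0 = trans (-‿cong (trans (*-congˡ (zero-sums zero)) (zeroʳ _))) -0#≈0#

      b-sums : ∀ j → sum (λ f → b f * M′ f j) ≈ 0#
      b-sums j = begin
        sum (λ f → b f * M′ f j)                      ≈⟨ sum-shift e (- a e) a (λ f → M′ f j) ⟩
        sum (λ f → a f * M′ f j) + (- a e) * M′ e j   ≈⟨ +-cong (sum-M⁰ a (suc j)) (trans (*-congˡ (row-e (suc j))) (zeroʳ _)) ⟩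
        sum (λ f → a f * M f (suc j)) + s a * M e (suc j) + 0#
          ≈⟨ +-congʳ (+-cong (zero-sums (suc j)) (trans (*-congʳ sa≈0) (zeroˡ _))) ⟩
        0# + 0# + 0#                                  ≈⟨ trans (+-identityʳ _) (+-identityʳ _) ⟩
        0#                                            ∎

      b≈0 : ∀ f → b f ≈ 0#
      b≈0 = ind b b-supp b-sums

      a-≢ : ∀ f → f ≢ e → a f ≈ 0#
      a-≢ f f≢e = trans (sym (b-≢ f f≢e)) (b≈0 f)

      a≈aₑδ : ∀ f → a f ≈ 0# + a e * δ e f
      a≈aₑδ f with f ≟ e
      ... | yes ≡.refl = sym (trans (+-identityˡ _) (trans (*-congˡ (δ-≡ e)) (*-identityʳ _)))
      ... | no f≢e = trans (a-≢ f f≢e)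
                           (sym (trans (+-identityˡ _) (trans (*-congˡ (δ-≢ e f f≢e)) (zeroʳ _))))

      aₑMₑ : a e * M e zero ≈ 0#
      aₑMₑ = begin
        a e * M e zero                                       ≈⟨ sym (+-identityˡ _) ⟩
        0# + a e * M e zero                                  ≈⟨ +-congʳ (sym (sum-≈0 {m} _ (λ f → zeroˡ (M f zero)))) ⟩
        sum (λ f → 0# * M f zero) + a e * M e zero           ≈⟨ sym (sum-shift e (a e) (λ _ → 0#) (λ f → M f zero)) ⟩
        sum (λ f → (0# + a e * δ e f) * M f zero)            ≈⟨ sum-cong-≋ {m} (λ f → *-congʳ (sym (a≈aₑδ f))) ⟩
        sum (λ f → a f * M f zero)                           ≈⟨ zero-sums zero ⟩
        0#                                                   ∎

      vanish : ∀ f → a f ≈ 0#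
      vanish f with f ≟ e
      ... | no f≢e = a-≢ f f≢e
      ... | yes ≡.refl = begin
        a e                      ≈⟨ sym (*-identityʳ _) ⟩
        a e * 1#                 ≈⟨ *-congˡ (sym (trans (*-comm _ _) y-inv)) ⟩
        a e * (M e zero * y)     ≈⟨ sym (*-assoc _ _ _) ⟩
        a e * M e zero * y       ≈⟨ *-congʳ aₑMₑ ⟩
        0# * y                   ≈⟨ zeroˡ _ ⟩
        0#                       ∎

    from : RowsIndependent M Y → RowsIndependent M′ (Y ∖ e)
    from ind a supp zero-sums = vanish
      where
      b : Fin m → Carrier
      b f = a f + s a * δ e f

      b-≢ : ∀ f → f ≢ e → b f ≈ a f
      b-≢ f f≢e = trans (+-congˡ (trans (*-congˡ (δ-≢ e f f≢e)) (zeroʳ _))) (+-identityʳ _)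

      b-supp : ∀ f → f ∉ Y → b f ≈ 0#
      b-supp f f∉Y = trans (b-≢ f λ { ≡.refl → f∉Y e∈Y })
                           (supp f λ f∈ → f∉Y (p─q⊆p Y ⁅ e ⁆ f∈))

      M⁰-sums : ∀ j → sum (λ f → a f * M⁰ f j) ≈ 0#
      M⁰-sums zero    = sum-≈0 {m} _ (λ f → trans (*-congˡ (column0 f)) (zeroʳ _))
      M⁰-sums (suc j) = zero-sums j

      b≈0 : ∀ f → b f ≈ 0#
      b≈0 = ind b b-supp λ j →
        trans (sum-shift e (s a) a (λ f → M f j)) (trans (sym (sum-M⁰ a j)) (M⁰-sums j))

      vanish : ∀ f → a f ≈ 0#
      vanish f with f ≟ e
      ... | yes ≡.refl = supp e (x∉p-x Y e)
      ... | no f≢e = trans (sym (b-≢ f f≢e)) (b≈0 f)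

  rowsIndependent? : ∀ {m N} (M : Matrix m N) → U.Decidable (RowsIndependent M)
  rowsIndependent? {N = zero} M Y with nonempty? Y
  ... | no  ∅ = yes λ a supp _ e → supp e λ e∈Y → ∅ (e , e∈Y)
  ... | yes (e , e∈Y) = no λ ind →
    1≉0 (trans (sym (δ-≡ e)) (ind (δ e) (λ f f∉Y → δ-≢ e f λ { ≡.refl → f∉Y e∈Y }) (λ ()) e))
    where
    1≉0 : ¬ 1# ≈ 0#
    1≉0 1≈0 = #-irrefl refl (invertible⇒# {0#} {0#} (0# , 0≈1 , 0≈1))
      where
      0≈1 : ∀ {x} → x ≈ 1#
      0≈1 {x} = trans (sym (*-identityʳ x)) (trans (*-congˡ 1≈0) (trans (zeroʳ x) (sym 1≈0)))
  rowsIndependent? {m} {suc N} M Y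
    with any? (λ e → (e ∈? Y) ×-dec ¬? (M e zero ≈0?))
  ... | yes (e , e∈Y , Me≉0) with inverse Me≉0
  ...   | y , y-inv = map′ to from (rowsIndependent? M′ (Y ∖ e))
    where open Pivot M Y e e∈Y y y-inv
  rowsIndependent? {m} {suc N} M Y | no ¬pivot =
    map′ (λ ind a supp sums → ind a supp (sums ∘ suc))
         (λ ind a supp sums → ind a supp λ where
            zero    → sum-≈0 {m} _ (column0 a supp)
            (suc j) → sums j)
         (rowsIndependent? (λ e j → M e (suc j)) Y)
    where
    column0 : ∀ a → (∀ e → e ∉ Y → a e ≈ 0#) → ∀ e → a e * M e zero ≈ 0#
    column0 a supp e with e ∈? Y
    ... | no e∉Y = trans (*-congʳ (supp e e∉Y)) (zeroˡ _)
    ... | yes e∈Y with M e zero ≈0?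
    ...   | yes z = trans (*-congˡ z) (zeroʳ _)
    ...   | no ¬z = ⊥-elim (¬pivot (e , e∈Y , ¬z))

-- The row matroid of the rigidity matrix of the complete graph on Fin n
-- realised by p; for generic p this is the generic rigidity matroid.
module Rigidity {c ℓ₁ ℓ₂} (K : HeytingField c ℓ₁ ℓ₂) (_#?_ : Decidable (HeytingField._#_ K))
                {n d : ℕ} (p : Fin n → Fin d → HeytingField.Carrier K) where
  open HeytingField K using (_-_; 0#)
  open LinearAlgebra K _#?_

  entry : Fin n × Fin n → Fin n × Fin d → HeytingField.Carrier K
  entry (u , v) (w , i) with w ≟ u | w ≟ v
  ... | yes _ | _     = p u i - p v i
  ... | no _  | yes _ = p v i - p u i
  ... | no _  | no _  = 0#

  -- Columns are indexed by vertex–coordinate pairs, flattened by `remQuot`.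
  rigidityMatrix : Matrix ∣K n ∣ (n ℕ.* d)
  rigidityMatrix e j = entry (ends e) (remQuot {n} d j)

  open Matroid (RowsIndependent rigidityMatrix) (rowsIndependent? rigidityMatrix) public

  IsRigidGraph : Subset n → EdgeSet n → Set
  IsRigidGraph W F = (IsComplete W F × ∣ W ∣ ℕ.≤ suc d)
                   ⊎ rank F ℕ.+ (suc d C 2) ≡ d ℕ.* ∣ W ∣

  IsRigid : EdgeSet n → Set
  IsRigid F = IsRigidGraph (spanned F) F

{-# OPTIONS --safe #-}

-- For generic p, span K(U) ∩ span K(W) = span K(U ∩ W): if a combination of
-- rows of K(U) vanishes in the columns of v, then the star at v is in
-- equilibrium, and the star-mesh transform rewrites it over K(U ∖ v).
-- Hence complete graphs form modular pairs; the same fact bounds the rank of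
-- K(W) by removing vertices one at a time, so that the closure of a cyclic
-- rigid set is the complete graph on its vertices.
--
-- Now intersect the closures cl (D ∖ Aᵢ) one by one. The intersection so far
-- contains the next part Aᵢ, so together with D ∖ Aᵢ it spans D, and by
-- modularity its rank drops by r(D) - r(D ∖ Aᵢ) = |Aᵢ| - 1. In the end it is
-- r(D) - |D| + ℓ = ℓ - k.
--
-- Genericity is used only through the affine independence of any d + 1 points,
-- which holds at some rational configuration and so at p.

module Submission where

open import Defs
open import Level using (Level; _⊔_)
open import Algebra.Apartness.Bundles using (HeytingField)
open import Algebra.Bundles using (CommutativeRing)
open import Algebra.Morphism.Construct.Identity using (isRingHomomorphism)
open import Algebra.Morphism.Structures using (IsRingHomomorphism)
open import Data.Empty using (⊥-elim)
open import Data.Fin.Base using (Fin; zero; suc; remQuot; combine; _<_)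
open import Data.Fin.Properties using (any?; _≟_; remQuot-combine; combine-remQuot; <-cmp; suc-injective)
  renaming (_<?_ to _<ᶠ?_; <-asym to <ᶠ-asym; <⇒≢ to <ᶠ⇒≢)
open import Data.Fin.Subset
  using (Subset; _∈_; _∉_; _⊆_; ⁅_⁆; _∪_; _∩_; _─_; ⋃; ⋂; ∣_∣; Nonempty; Empty; inside; outside)
  renaming (_-_ to _∖_; ⊥ to ∅; ⊤ to full)
open import Data.Fin.Subset.Properties
open import Data.List.Base as List using (List; []; _∷_; allFin; cartesianProduct)
open import Data.List.Membership.Propositional using () renaming (_∈_ to _∈ˡ_)
open import Data.List.Membership.Propositional.Properties
  using (∈-map⁺; ∈-map⁻; ∈-++⁺ˡ; ∈-++⁺ʳ; ∈-filter⁺; ∈-filter⁻; ∈-lookup; ∈-cartesianProduct⁺; ∈-allFin)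
open import Data.List.Relation.Unary.All as All using ([]; _∷_)
open import Data.List.Relation.Unary.AllPairs using (_∷_)
open import Data.List.Relation.Unary.Any as Any using (here)
open import Data.List.Relation.Unary.Any.Properties using (lookup-index)
open import Data.List.Relation.Unary.Unique.Propositional using (Unique)
import Data.List.Relation.Unary.Unique.Propositional.Properties as Unique
open import Data.Nat.Base as ℕ using (ℕ; zero; suc; z≤n; s≤s; _≤_; _∸_)
open import Data.Nat.Combinatorics using (_C_; nC1≡n; nCk+nC[k+1]≡[n+1]C[k+1])
import Data.Nat.Properties as ℕ
open import Data.List.Extrema ℕ.≤-totalOrder using (xs≤max; argmax-sel)
open import Data.Nat.Solver using (module +-*-Solver)
open import Data.Product.Base using (∃; _×_; _,_; proj₁; proj₂; uncurry)
open import Data.Rational.Base as ℚ using (ℚ; 0ℚ; 1ℚ; +-*-rawRing)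
import Data.Rational.Properties as ℚ
open import Data.Sum.Base using (_⊎_; inj₁; inj₂; [_,_]′)
import Data.Vec.Base as Vec
import Data.Vec.Properties as Vec
open import Function.Base using (_∘_; id)
open import Function.Bundles using (Equivalence)
open import Relation.Binary.Definitions using (Decidable; tri<; tri≈; tri>)
open import Relation.Binary.PropositionalEquality as ≡ using (_≡_; _≢_)
open import Relation.Nullary using (Dec; yes; no; ¬_)
open import Relation.Nullary.Decidable using (_×-dec_; _⊎-dec_; ¬?; ⌊_⌋; dec-true; isYes≗does; decidable-stable)
open +-*-Solver using (solve; _:+_; _:*_; _:=_; con)

-- Submodularity gives only one half of each rank drop: two flats can share vectors that their
-- common edges do not span, and then the rank of the intersection drops further. Complete graphs
-- exclude this, so the induction has to keep every intermediate intersection a complete graph; it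
-- can, because K(U) ∩ K(W) = K(U ∩ W).
--
-- The drop itself is a comparison of nullities: D has nullity k and D ∖ Aᵢ has nullity k - 1, so
-- removing the |Aᵢ| edges of a part costs |Aᵢ| - 1 in rank.
--
-- Two points need care. The star-mesh transform divides by the sum of the coefficients at v, so
-- stars with sum zero are treated separately. And the count d|W| - C(d+1,2) alone does not identify
-- the closure of F: on fewer than d vertices it is smaller than the rank of K(W). There cyclicity
-- decides, since K(W) is independent as long as W has at most d + 1 vertices.

-- Finite subsets, their cardinalities, indexed unions and intersections

∣p∪q∣≡∣p∣+∣q∣ : ∀ {m} (p q : Subset m) → Empty (p ∩ q) → ∣ p ∪ q ∣ ≡ ∣ p ∣ ℕ.+ ∣ q ∣
∣p∪q∣≡∣p∣+∣q∣ Vec.[] Vec.[] _ = ≡.refl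
∣p∪q∣≡∣p∣+∣q∣ (outside Vec.∷ p) (outside Vec.∷ q) e = ∣p∪q∣≡∣p∣+∣q∣ p q (drop-∷-Empty e)
∣p∪q∣≡∣p∣+∣q∣ (outside Vec.∷ p) (inside Vec.∷ q) e =
  ≡.trans (≡.cong suc (∣p∪q∣≡∣p∣+∣q∣ p q (drop-∷-Empty e))) (≡.sym (ℕ.+-suc _ _))
∣p∪q∣≡∣p∣+∣q∣ (inside Vec.∷ p) (outside Vec.∷ q) e = ≡.cong suc (∣p∪q∣≡∣p∣+∣q∣ p q (drop-∷-Empty e))
∣p∪q∣≡∣p∣+∣q∣ (inside Vec.∷ p) (inside Vec.∷ q) e = ⊥-elim (e (zero , Vec.here))

x∉p⇒∣p∪⁅x⁆∣ : ∀ {m} {p : Subset m} {x} → x ∉ p → ∣ p ∪ ⁅ x ⁆ ∣ ≡ suc ∣ p ∣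
x∉p⇒∣p∪⁅x⁆∣ {p = p} {x} x∉p = begin
  ∣ p ∪ ⁅ x ⁆ ∣       ≡⟨ ∣p∪q∣≡∣p∣+∣q∣ p ⁅ x ⁆ disjoint ⟩
  ∣ p ∣ ℕ.+ ∣ ⁅ x ⁆ ∣ ≡⟨ ≡.cong (∣ p ∣ ℕ.+_) (∣⁅x⁆∣≡1 x) ⟩
  ∣ p ∣ ℕ.+ 1         ≡⟨ ℕ.+-comm _ 1 ⟩
  suc ∣ p ∣           ∎
  where
  open ≡.≡-Reasoning
  disjoint : Empty (p ∩ ⁅ x ⁆)
  disjoint (y , y∈) with x∈p∩q⁻ p ⁅ x ⁆ y∈
  ... | y∈p , y∈x = x∉p (≡.subst (_∈ p) (x∈⁅y⁆⇒x≡y x y∈x) y∈p)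

∪-least : ∀ {m} {p q r : Subset m} → p ⊆ r → q ⊆ r → p ∪ q ⊆ r
∪-least {p = p} {q} p⊆r q⊆r x∈ with x∈p∪q⁻ p q x∈
... | inj₁ x∈p = p⊆r x∈p
... | inj₂ x∈q = q⊆r x∈q

x∈p∪⁅y⁆∧x≢y⇒x∈p : ∀ {m} {p : Subset m} {x y} → x ∈ p ∪ ⁅ y ⁆ → x ≢ y → x ∈ p
x∈p∪⁅y⁆∧x≢y⇒x∈p {p = p} {y = y} x∈ x≢y with x∈p∪q⁻ p ⁅ y ⁆ x∈
... | inj₁ x∈p = x∈p
... | inj₂ x∈y = ⊥-elim (x≢y (x∈⁅y⁆⇒x≡y y x∈y))

⁅x⁆⊆p : ∀ {m} {p : Subset m} {x} → x ∈ p → ⁅ x ⁆ ⊆ p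
⁅x⁆⊆p {x = x} x∈p y∈ = ≡.subst (_∈ _) (≡.sym (x∈⁅y⁆⇒x≡y x y∈)) x∈p

p⊆p-x∪⁅x⁆ : ∀ {m} (p : Subset m) x → p ⊆ (p ∖ x) ∪ ⁅ x ⁆
p⊆p-x∪⁅x⁆ p x {y} y∈p with y ≟ x
... | yes ≡.refl = q⊆p∪q (p ∖ x) ⁅ x ⁆ (x∈⁅x⁆ x)
... | no y≢x = p⊆p∪q ⁅ x ⁆ (x∈p∧x≢y⇒x∈p-y y∈p y≢x)

x∉p-x : ∀ {m} (p : Subset m) x → x ∉ p ∖ x
x∉p-x (_ Vec.∷ p) zero    ()
x∉p-x (_ Vec.∷ p) (suc x) (Vec.there x∈) = x∉p-x p x x∈

∣p∣≤1+∣p-x∣ : ∀ {m} (p : Subset m) x → ∣ p ∣ ℕ.≤ suc ∣ p ∖ x ∣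
∣p∣≤1+∣p-x∣ p x = ≡.subst (∣ p ∣ ℕ.≤_) (x∉p⇒∣p∪⁅x⁆∣ (x∉p-x p x)) (p⊆q⇒∣p∣≤∣q∣ (p⊆p-x∪⁅x⁆ p x))

∈-subsets : ∀ {m} (Y : Subset m) → Y ∈ˡ subsets m
∈-subsets Vec.[] = here ≡.refl
∈-subsets (outside Vec.∷ Y) = ∈-++⁺ˡ (∈-map⁺ (outside Vec.∷_) (∈-subsets Y))
∈-subsets {suc m} (inside Vec.∷ Y) =
  ∈-++⁺ʳ (List.map (outside Vec.∷_) (subsets m)) (∈-map⁺ (inside Vec.∷_) (∈-subsets Y))

∈-tabulate⁺ : ∀ {m p} {P : Fin m → Set p} (P? : ∀ x → Dec (P x)) {x} → P x → x ∈ Vec.tabulate (λ y → ⌊ P? y ⌋)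
∈-tabulate⁺ P? {x} px = Vec.lookup⇒[]= x _ (≡.trans (Vec.lookup∘tabulate _ x) (≡.trans (isYes≗does (P? x)) (dec-true (P? x) px)))

∈-tabulate⁻ : ∀ {m p} {P : Fin m → Set p} (P? : ∀ x → Dec (P x)) {x} → x ∈ Vec.tabulate (λ y → ⌊ P? y ⌋) → P x
∈-tabulate⁻ P? {x} x∈ with P? x | ≡.trans (≡.sym (Vec.lookup∘tabulate (λ y → ⌊ P? y ⌋) x)) (Vec.[]=⇒lookup x∈)
... | yes px | _  = px
... | no  _  | ()

x∈p─q⇒x∉q : ∀ {m} (p q : Subset m) {x} → x ∈ p ─ q → x ∉ q
x∈p─q⇒x∉q (_ Vec.∷ p) (inside Vec.∷ q) () Vec.here
x∈p─q⇒x∉q (_ Vec.∷ p) (_ Vec.∷ q) (Vec.there x∈) (Vec.there x∈q) = x∈p─q⇒x∉q p q x∈ x∈q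

∈⋂⁺ : ∀ {m ℓ} {f : Fin ℓ → Subset m} {x} → (∀ i → x ∈ f i) → x ∈ ⋂ (List.tabulate f)
∈⋂⁺ {ℓ = zero}  _  = ∈⊤
∈⋂⁺ {ℓ = suc ℓ} x∈ = x∈p∩q⁺ (x∈ zero , ∈⋂⁺ (x∈ ∘ suc))

∈⋃⁺ : ∀ {m ℓ} (f : Fin ℓ → Subset m) i → f i ⊆ ⋃ (List.tabulate f)
∈⋃⁺ f zero    x∈ = p⊆p∪q (⋃ (List.tabulate (f ∘ suc))) x∈
∈⋃⁺ f (suc i) x∈ = q⊆p∪q (f zero) (⋃ (List.tabulate (f ∘ suc))) (∈⋃⁺ (f ∘ suc) i x∈)

∈⋃⁻ : ∀ {m ℓ} (f : Fin ℓ → Subset m) {x} → x ∈ ⋃ (List.tabulate f) → ∃ λ i → x ∈ f i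
∈⋃⁻ {ℓ = zero}  f x∈ = ⊥-elim (∉⊥ x∈)
∈⋃⁻ {ℓ = suc ℓ} f x∈ with x∈p∪q⁻ (f zero) (⋃ (List.tabulate (f ∘ suc))) x∈
... | inj₁ x∈₀ = zero , x∈₀
... | inj₂ x∈₊ = let i , x∈i = ∈⋃⁻ (f ∘ suc) x∈₊ in suc i , x∈i

q⊆p⇒∣p─q∣+∣q∣ : ∀ {m} {p q : Subset m} → q ⊆ p → ∣ p ─ q ∣ ℕ.+ ∣ q ∣ ≡ ∣ p ∣
q⊆p⇒∣p─q∣+∣q∣ {p = p} {q} q⊆p = ≡.trans
  (≡.sym (∣p∪q∣≡∣p∣+∣q∣ (p ─ q) q λ (x , x∈) → let x∈p─q , x∈q = x∈p∩q⁻ (p ─ q) q x∈ in x∈p─q⇒x∉q p q x∈p─q x∈q))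
  (≡.cong ∣_∣ (⊆-antisym (∪-least (p─q⊆p p q) q⊆p) p⊆))
  where
  p⊆ : p ⊆ (p ─ q) ∪ q
  p⊆ {x} x∈p with x ∈? q
  ... | yes x∈q = q⊆p∪q (p ─ q) q x∈q
  ... | no  x∉q = p⊆p∪q q (x∈p∧x∉q⇒x∈p─q x∈p x∉q)

subset-of-size : ∀ {m} k (p : Subset m) → k ℕ.≤ ∣ p ∣ → ∃ λ q → q ⊆ p × ∣ q ∣ ≡ k
subset-of-size {m} zero p _ = ∅ , ⊥⊆ , ∣⊥∣≡0 m
subset-of-size (suc k) (outside Vec.∷ p) k≤ with subset-of-size (suc k) p k≤
... | q , q⊆p , eq = outside Vec.∷ q , out⊆ q⊆p , eq
subset-of-size (suc k) (inside Vec.∷ p) (s≤s k≤) with subset-of-size k p k≤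
... | q , q⊆p , eq = inside Vec.∷ q , in⊆in q⊆p , ≡.cong suc eq

-- Row combinations, spans and the exchange inequality

module LinearSpan {c ℓ₁ ℓ₂} (K : HeytingField c ℓ₁ ℓ₂) (_#?_ : Decidable (HeytingField._#_ K)) where
  open HeytingField K hiding (setoid; zero)
  open CommutativeRing (ring K) using (semiring; setoid)
  open LinearAlgebra K _#?_ hiding (x∉p-x)
  open import Algebra.Properties.Semiring.Sum semiring
    using (sum; sum-cong-≋; ∑-distrib-+; ∑-comm; *-distribˡ-sum; *-distribʳ-sum)
  open import Algebra.Properties.Ring (CommutativeRing.ring (ring K)) using (-‿distribˡ-*)
  open import Relation.Binary.Reasoning.Setoid setoid

  1≉0 : ¬ 1# ≈ 0#
  1≉0 1≈0 = #-irrefl refl (invertible⇒# {0#} {0#} (0# , 0≈1 , 0≈1))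
    where
    0≈1 : ∀ {x} → x ≈ 1#
    0≈1 {x} = trans (sym (*-identityʳ x)) (trans (*-congˡ 1≈0) (trans (zeroʳ x) (sym 1≈0)))

  x*y≈0⇒y≈0 : ∀ {x y} → ¬ x ≈ 0# → x * y ≈ 0# → y ≈ 0#
  x*y≈0⇒y≈0 {x} {y} x≉0 xy≈0 with inverse x≉0
  ... | z , zx = begin
    y            ≈⟨ *-identityˡ y ⟨
    1# * y       ≈⟨ *-congʳ zx ⟨
    z * x * y    ≈⟨ *-assoc z x y ⟩
    z * (x * y)  ≈⟨ *-congˡ xy≈0 ⟩
    z * 0#       ≈⟨ zeroʳ z ⟩
    0#           ∎

  ∑-cong : ∀ {m} {f g : Fin m → Carrier} → (∀ e → f e ≈ g e) → sum f ≈ sum g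
  ∑-cong {m} = sum-cong-≋ {m}

  Supported : ∀ {m} → Subset m → (Fin m → Carrier) → Set ℓ₁
  Supported X a = ∀ e → e ∉ X → a e ≈ 0#

  Supported-⊆ : ∀ {m} {X Y : Subset m} {a} → X ⊆ Y → Supported X a → Supported Y a
  Supported-⊆ X⊆Y supp e e∉Y = supp e (e∉Y ∘ X⊆Y)

  supported-*≈0 : ∀ {m} {X : Subset m} {a t : Fin m → Carrier} → Supported X a → (∀ e → e ∈ X → t e ≈ 0#) → ∀ e → a e * t e ≈ 0#
  supported-*≈0 {X = X} supp t≈0 e with e ∈? X
  ... | yes e∈X = trans (*-congˡ (t≈0 e e∈X)) (zeroʳ _)
  ... | no  e∉X = trans (*-congʳ (supp e e∉X)) (zeroˡ _)

  column0-≈0 : ∀ {m N} {M : Matrix m (suc N)} {Y} → ¬ (∃ λ e → e ∈ Y × ¬ M e zero ≈ 0#) →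
    ∀ e → e ∈ Y → M e zero ≈ 0#
  column0-≈0 {M = M} ¬pivot e e∈Y = decidable-stable (M e zero ≈0?) λ Me≉0 → ¬pivot (e , e∈Y , Me≉0)

  δ-supported : ∀ {m} {X : Subset m} {e} → e ∈ X → Supported X (δ e)
  δ-supported {e = e} e∈X f f∉X = δ-≢ e f λ { ≡.refl → f∉X e∈X }

  combination : ∀ {m N} → (Fin m → Carrier) → Matrix m N → Fin N → Carrier
  combination a M j = sum λ e → a e * M e j

  combination-+ : ∀ {m N} (a b : Fin m → Carrier) (M : Matrix m N) j →
    combination (λ e → a e + b e) M j ≈ combination a M j + combination b M j
  combination-+ a b M j = trans (∑-cong λ e → distribʳ (M e j) (a e) (b e))
                                (∑-distrib-+ (λ e → a e * M e j) (λ e → b e * M e j))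

  combination-* : ∀ {m N} s (a : Fin m → Carrier) (M : Matrix m N) j →
    combination (λ e → s * a e) M j ≈ s * combination a M j
  combination-* s a M j = trans (∑-cong λ e → *-assoc s (a e) (M e j))
                                (sym (*-distribˡ-sum s (λ e → a e * M e j)))

  combination-assoc : ∀ {m r N} (a : Fin m → Carrier) (T : Matrix m r) (M : Matrix r N) j →
    combination (combination a T) M j ≈ combination a (λ e → combination (T e) M) j
  combination-assoc a T M j = begin
    sum (λ f → sum (λ e → a e * T e f) * M f j)
      ≈⟨ ∑-cong (λ f → *-distribʳ-sum (M f j) (λ e → a e * T e f)) ⟩
    sum (λ f → sum (λ e → a e * T e f * M f j))
      ≈⟨ ∑-comm (λ f e → a e * T e f * M f j) ⟩
    sum (λ e → sum (λ f → a e * T e f * M f j))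
      ≈⟨ ∑-cong (λ e → trans (∑-cong λ f → *-assoc (a e) (T e f) (M f j)) (sym (*-distribˡ-sum (a e) (λ f → T e f * M f j)))) ⟩
    sum (λ e → a e * sum (λ f → T e f * M f j)) ∎

  Dependency : ∀ {m N} → Matrix m N → Subset m → Set (c ⊔ ℓ₁)
  Dependency M Y = ∃ λ a → Supported Y a × (∀ j → combination a M j ≈ 0#) × ∃ λ e → ¬ a e ≈ 0#

  -- Refuting `RowsIndependent` yields no coefficients constructively, whereas later steps compute
  -- with a dependency. The elimination is therefore run again, carrying a witness.
  independent-or-dependent : ∀ {m N} (M : Matrix m N) Y → RowsIndependent M Y ⊎ Dependency M Y
  independent-or-dependent {N = zero} M Y with nonempty? Y
  ... | no  empty     = inj₁ λ a supp _ e → supp e λ e∈Y → empty (e , e∈Y)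
  ... | yes (e , e∈Y) = inj₂ (δ e , δ-supported e∈Y , (λ ()) , e , 1≉0 ∘ trans (sym (δ-≡ e)))
  independent-or-dependent {m} {suc N} M Y
    with any? (λ e → (e ∈? Y) ×-dec ¬? (M e zero ≈0?))
  ... | yes (e , e∈Y , Me≉0) = pivot (inverse Me≉0)
    where
    pivot : ∃ (λ y → y * M e zero ≈ 1#) → RowsIndependent M Y ⊎ Dependency M Y
    pivot (y , y-inv) with independent-or-dependent (Pivot.M′ M Y e e∈Y y y-inv) (Y ∖ e)
    ... | inj₁ ind = inj₁ (Pivot.to M Y e e∈Y y y-inv ind)
    ... | inj₂ (a , supp , sums , f , af≉0) = inj₂ (b , b-supp , b-sums , f , af≉0 ∘ trans (sym (b-≢ f f≢e)))
      where
      open Pivot M Y e e∈Y y y-inv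
      b : Fin m → Carrier
      -- `s a` is the coefficient of the pivot row that makes column zero cancel.
      b g = a g + s a * δ e g
      b-≢ : ∀ g → g ≢ e → b g ≈ a g
      b-≢ g g≢e = trans (+-congˡ (trans (*-congˡ (δ-≢ e g g≢e)) (zeroʳ _))) (+-identityʳ _)
      f≢e : f ≢ e
      f≢e ≡.refl = af≉0 (supp e (x∉p-x Y e))
      b-supp : Supported Y b
      b-supp g g∉Y = trans (b-≢ g λ { ≡.refl → g∉Y e∈Y }) (supp g (g∉Y ∘ p─q⊆p Y ⁅ e ⁆))
      M⁰-sums : ∀ j → combination a M⁰ j ≈ 0#
      M⁰-sums zero    = sum-≈0 {m} _ λ g → trans (*-congˡ (column0 g)) (zeroʳ _)
      M⁰-sums (suc j) = sums j
      b-sums : ∀ j → combination b M j ≈ 0#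
      b-sums j = trans (sum-shift e (s a) a (λ g → M g j)) (trans (sym (sum-M⁰ a j)) (M⁰-sums j))
  independent-or-dependent {m} {suc N} M Y | no ¬pivot
    with independent-or-dependent (λ e j → M e (suc j)) Y
  ... | inj₁ ind = inj₁ λ a supp sums → ind a supp (sums ∘ suc)
  ... | inj₂ (a , supp , sums , w) = inj₂ (a , supp , sums′ , w)
    where
    sums′ : ∀ j → combination a M j ≈ 0#
    sums′ zero    = sum-≈0 {m} _ (supported-*≈0 supp (column0-≈0 {M = M} ¬pivot))
    sums′ (suc j) = sums j

  independent-size : ∀ {m N} (M : Matrix m N) Y (B : Subset N) →
    (∀ e → e ∈ Y → Supported B (M e)) → RowsIndependent M Y → ∣ Y ∣ ℕ.≤ ∣ B ∣
  independent-size {m} M Y Vec.[] supp ind with nonempty? Y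
  ... | no empty = ℕ.≤-reflexive (≡.trans (≡.cong ∣_∣ (Empty-unique empty)) (∣⊥∣≡0 m))
  ... | yes (e , e∈Y) = ⊥-elim (1≉0 (trans (sym (δ-≡ e)) (ind (δ e) (δ-supported e∈Y) (λ ()) e)))
  independent-size {m} {suc N} M Y (b Vec.∷ B) supp ind
    with any? (λ e → (e ∈? Y) ×-dec ¬? (M e zero ≈0?))
  ... | no ¬pivot = ℕ.≤-trans
    (independent-size (λ e j → M e (suc j)) Y B (λ e e∈Y j j∉B → supp e e∈Y (suc j) (j∉B ∘ drop-there))
      λ a a-supp sums → ind a a-supp λ where
        zero    → sum-≈0 {m} _ (supported-*≈0 a-supp (column0-≈0 {M = M} ¬pivot))
        (suc j) → sums j)
    (∣p∣≤∣x∷p∣ b B)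
  independent-size {m} {suc N} M Y (outside Vec.∷ B) supp ind | yes (e , e∈Y , Me≉0) =
    ⊥-elim (Me≉0 (supp e e∈Y zero λ ()))
  independent-size {m} {suc N} M Y (inside Vec.∷ B) supp ind | yes (e , e∈Y , Me≉0) with inverse Me≉0
  ... | y , y-inv = ℕ.≤-trans (∣p∣≤1+∣p-x∣ Y e)
    (s≤s (independent-size M′ (Y ∖ e) B M′-supp (from ind)))
    where
    open Pivot M Y e e∈Y y y-inv
    M′-supp : ∀ f → f ∈ Y ∖ e → Supported B (M′ f)
    M′-supp f f∈ j j∉B = trans
      (+-cong (supp f (p─q⊆p Y ⁅ e ⁆ f∈) (suc j) (j∉B ∘ drop-there))
              (trans (*-congˡ (supp e e∈Y (suc j) (j∉B ∘ drop-there))) (zeroʳ _)))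
      (+-identityʳ 0#)

  module _ {m N} (M : Matrix m N) where

    InSpan : Subset m → (Fin N → Carrier) → Set (c ⊔ ℓ₁)
    InSpan X v = ∃ λ a → Supported X a × (∀ j → combination a M j ≈ v j)

    Spans : Subset m → Subset m → Set (c ⊔ ℓ₁)
    Spans B X = ∀ e → e ∈ X → InSpan B (M e)

    row-inSpan : ∀ {X e} → e ∈ X → InSpan X (M e)
    row-inSpan {e = e} e∈X = δ e , δ-supported e∈X , λ j → sum-δ e (λ f → M f j)

    InSpan-⊆ : ∀ {X Y v} → X ⊆ Y → InSpan X v → InSpan Y v
    InSpan-⊆ X⊆Y (a , supp , sums) = a , Supported-⊆ X⊆Y supp , sums

    spanning-coefficients : ∀ {B X} → Spans B X → ∃ λ (T : Matrix m m) →
      (∀ e → Supported B (T e)) × (∀ e → e ∈ X → ∀ j → combination (T e) M j ≈ M e j)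
    spanning-coefficients {B} {X} spans = T , T-supp , T-row
      where
      T : Matrix m m
      T e with e ∈? X
      ... | yes e∈X = proj₁ (spans e e∈X)
      -- Zero rows off `X` keep every row of `T` supported in `B`.
      ... | no  _   = λ _ → 0#
      T-supp : ∀ e → Supported B (T e)
      T-supp e with e ∈? X
      ... | yes e∈X = proj₁ (proj₂ (spans e e∈X))
      ... | no  _   = λ _ _ → refl
      T-row : ∀ e → e ∈ X → ∀ j → combination (T e) M j ≈ M e j
      T-row e e∈X with e ∈? X
      ... | yes e∈X = proj₂ (proj₂ (spans e e∈X))
      ... | no  e∉X = ⊥-elim (e∉X e∈X)

    respan : ∀ {X} (T : Matrix m m) → (∀ e → e ∈ X → ∀ j → combination (T e) M j ≈ M e j) →
      ∀ a → Supported X a → ∀ j → combination (combination a T) M j ≈ combination a M j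
    respan {X} T T-row a supp j = trans (combination-assoc a T M j) (∑-cong term)
      where
      term : ∀ e → a e * combination (T e) M j ≈ a e * M e j
      term e with e ∈? X
      ... | yes e∈X = *-congˡ (T-row e e∈X j)
      ... | no  e∉X = trans (*-congʳ (supp e e∉X)) (trans (zeroˡ _) (sym (trans (*-congʳ (supp e e∉X)) (zeroˡ _))))

    InSpan-trans : ∀ {B X v} → Spans B X → InSpan X v → InSpan B v
    InSpan-trans spans (a , supp , sums) with spanning-coefficients spans
    ... | T , T-supp , T-row = combination a T
      , (λ f f∉B → sum-≈0 {m} _ λ e → trans (*-congˡ (T-supp e f f∉B)) (zeroʳ _))
      , λ j → trans (respan T T-row a supp j) (sums j)

    -- A vanishing combination of the coefficient vectors over `B` is a vanishing combination of the
    -- rows in `Y`. So the coefficient vectors are independent, and they live on the columns `B`.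
    steinitz : ∀ {B Y} → RowsIndependent M Y → Spans B Y → ∣ Y ∣ ℕ.≤ ∣ B ∣
    steinitz {B} {Y} ind spans with spanning-coefficients spans
    ... | T , T-supp , T-row = independent-size T Y B (λ e _ → T-supp e) λ a supp sums →
      ind a supp λ j → trans (sym (respan T T-row a supp j))
                             (sum-≈0 {m} _ λ f → trans (*-congʳ (sums f)) (zeroˡ _))

    independent-⊆ : ∀ {X Y} → X ⊆ Y → RowsIndependent M Y → RowsIndependent M X
    independent-⊆ X⊆Y ind a supp = ind a (Supported-⊆ X⊆Y supp)

    -- Since `B` is independent, a dependency of `B ∪ ⁅ e ⁆` involves `e`; dividing by the
    -- coefficient of `e` solves for its row.
    adjoin : ∀ {B} e → RowsIndependent M B → RowsIndependent M (B ∪ ⁅ e ⁆) ⊎ InSpan B (M e)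
    adjoin {B} e ind with independent-or-dependent M (B ∪ ⁅ e ⁆)
    ... | inj₁ ind′ = inj₁ ind′
    ... | inj₂ (a , supp , sums , f , af≉0) with a e ≈0?
    ...   | yes ae≈0 = ⊥-elim (af≉0 (ind a a-supp sums f))
      where
      a-supp : Supported B a
      a-supp g g∉B with g ≟ e
      ... | yes ≡.refl = ae≈0
      ... | no g≢e = supp g λ g∈ → g∉B (x∈p∪⁅y⁆∧x≢y⇒x∈p g∈ g≢e)
    ...   | no ae≉0 = inj₂ (b , b-supp , b-sums)
      where
      y = proj₁ (inverse ae≉0)
      yae = proj₂ (inverse ae≉0)
      b : Fin m → Carrier
      b g = - y * a g + 1# * δ e g
      b-e : b e ≈ 0#
      b-e = begin
        - y * a e + 1# * δ e e  ≈⟨ +-cong (trans (sym (-‿distribˡ-* y (a e))) (-‿cong yae)) (trans (*-identityˡ _) (δ-≡ e)) ⟩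
        - 1# + 1#               ≈⟨ -‿inverseˡ 1# ⟩
        0#                      ∎
      b-supp : Supported B b
      b-supp g g∉B with g ≟ e
      ... | yes ≡.refl = b-e
      ... | no g≢e = begin
        - y * a g + 1# * δ e g  ≈⟨ +-cong (*-congˡ (supp g λ g∈ → g∉B (x∈p∪⁅y⁆∧x≢y⇒x∈p g∈ g≢e))) (*-congˡ (δ-≢ e g g≢e)) ⟩
        - y * 0# + 1# * 0#      ≈⟨ +-cong (zeroʳ _) (zeroʳ _) ⟩
        0# + 0#                 ≈⟨ +-identityʳ 0# ⟩
        0#                      ∎
      b-sums : ∀ j → combination b M j ≈ M e j
      b-sums j = begin
        combination b M j
          ≈⟨ sum-shift e 1# (λ g → - y * a g) (λ g → M g j) ⟩
        combination (λ g → - y * a g) M j + 1# * M e j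
          ≈⟨ +-cong (trans (combination-* (- y) a M j) (trans (*-congˡ (sums j)) (zeroʳ _))) (*-identityˡ _) ⟩
        0# + M e j
          ≈⟨ +-identityˡ _ ⟩
        M e j ∎

-- Bases, rank, closure and modular pairs in a row matroid

module LinearRank {c ℓ₁ ℓ₂} (K : HeytingField c ℓ₁ ℓ₂) (_#?_ : Decidable (HeytingField._#_ K)) where
  open HeytingField K hiding (setoid; zero)
  open CommutativeRing (ring K) using (setoid; +-group)
  open import Algebra.Properties.Ring (CommutativeRing.ring (ring K)) using (-1*x≈-x)
  open import Algebra.Properties.Group +-group using () renaming (inverseʳ-unique to +-inverseʳ-unique)
  open import Relation.Binary.Reasoning.Setoid setoid using (begin_; step-≈-⟩; step-≈-⟨; _∎)
  open LinearAlgebra K _#?_ hiding (x∉p-x)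
  open LinearSpan K _#?_

  module _ {m N} (M : Matrix m N) where
    open Matroid (RowsIndependent M) (rowsIndependent? M)

    ∅-independent : RowsIndependent M ∅
    ∅-independent a supp _ e = supp e ∉⊥

    independent⇒∣∣≤rank : ∀ {X Y} → Y ⊆ X → RowsIndependent M Y → ∣ Y ∣ ℕ.≤ rank X
    independent⇒∣∣≤rank {X} {Y} Y⊆X ind = All.lookup (xs≤max 0 _)
      (∈-map⁺ ∣_∣ (∈-filter⁺ (λ Z → (Z ⊆? X) ×-dec rowsIndependent? M Z) (∈-subsets Y) (Y⊆X , ind)))

    rank-attained : ∀ X → ∃ λ Y → Y ⊆ X × RowsIndependent M Y × ∣ Y ∣ ≡ rank X
    rank-attained X with argmax-sel id 0 (List.map ∣_∣ (List.filter (λ Z → (Z ⊆? X) ×-dec rowsIndependent? M Z) (subsets m)))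
    -- The default value 0 of `max` is the size of the independent set `∅`.
    ... | inj₁ r≡0 = ∅ , ⊥⊆ , ∅-independent , ≡.trans (∣⊥∣≡0 m) (≡.sym r≡0)
    ... | inj₂ r∈ with ∈-map⁻ ∣_∣ r∈
    ...   | Y , Y∈ , r≡ with ∈-filter⁻ (λ Z → (Z ⊆? X) ×-dec rowsIndependent? M Z) {xs = subsets m} Y∈
    ...     | _ , Y⊆X , ind = Y , Y⊆X , ind , ≡.sym r≡

    IsBasis : Subset m → Subset m → Set (c ⊔ ℓ₁)
    IsBasis B X = B ⊆ X × RowsIndependent M B × Spans M B X

    basis-size : ∀ {B X} → IsBasis B X → ∣ B ∣ ≡ rank X
    basis-size {B} {X} (B⊆X , ind , spans) = ℕ.≤-antisym (independent⇒∣∣≤rank B⊆X ind) (rank≤ (rank-attained X))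
      where
      rank≤ : (∃ λ Y → Y ⊆ X × RowsIndependent M Y × ∣ Y ∣ ≡ rank X) → rank X ℕ.≤ ∣ B ∣
      rank≤ (Y , Y⊆X , indY , r) = ≡.subst (ℕ._≤ ∣ B ∣) r (steinitz M indY (λ e e∈Y → spans e (Y⊆X e∈Y)))

    rank≤∣∣ : ∀ X → rank X ℕ.≤ ∣ X ∣
    rank≤∣∣ X with rank-attained X
    ... | B , B⊆X , ind , r = ≡.subst (ℕ._≤ _) r (p⊆q⇒∣p∣≤∣q∣ B⊆X)

    full-independent-spans : ∀ {B X} → B ⊆ X → RowsIndependent M B → rank X ℕ.≤ ∣ B ∣ → Spans M B X
    full-independent-spans {B} {X} B⊆X ind r≤ e e∈X with e ∈? B
    ... | yes e∈B = row-inSpan M e∈B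
    ... | no  e∉B with adjoin M e ind
    ...   | inj₂ spanned = spanned
    ...   | inj₁ ind′ = ⊥-elim (ℕ.<⇒≱ (ℕ.n<1+n ∣ B ∣) (ℕ.≤-trans
              (ℕ.≤-reflexive (≡.sym (x∉p⇒∣p∪⁅x⁆∣ e∉B)))
              (ℕ.≤-trans (independent⇒∣∣≤rank (∪-least B⊆X (⁅x⁆⊆p e∈X)) ind′) r≤)))

    -- `t` is fuel: it bounds the number of rows that `B` lacks to reach the rank of `X`. When it is
    -- used up, `B` is a largest independent subset and hence spans.
    extend-within : ∀ t {B X} → B ⊆ X → RowsIndependent M B → rank X ℕ.≤ t ℕ.+ ∣ B ∣ →
      ∃ λ B′ → B ⊆ B′ × IsBasis B′ X
    extend-within zero B⊆X ind r≤ = _ , id , B⊆X , ind , full-independent-spans B⊆X ind r≤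
    extend-within (suc t) {B} {X} B⊆X ind r≤
      with any? (λ e → ((e ∈? X) ×-dec ¬? (e ∈? B)) ×-dec rowsIndependent? M (B ∪ ⁅ e ⁆))
    ... | yes (e , (e∈X , e∉B) , ind′)
      with extend-within t (∪-least B⊆X (⁅x⁆⊆p e∈X)) ind′
             (ℕ.≤-trans r≤ (ℕ.≤-reflexive (≡.trans (≡.sym (ℕ.+-suc t _)) (≡.cong (t ℕ.+_) (≡.sym (x∉p⇒∣p∪⁅x⁆∣ e∉B))))))
    ...   | B′ , B∪e⊆B′ , basis = B′ , B∪e⊆B′ ∘ p⊆p∪q ⁅ e ⁆ , basis
    extend-within (suc t) {B} {X} B⊆X ind r≤ | no maximal = _ , id , B⊆X , ind , spans
      where
      spans : Spans M B X
      spans e e∈X with e ∈? B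
      ... | yes e∈B = row-inSpan M e∈B
      ... | no e∉B with adjoin M e ind
      ...   | inj₂ spanned = spanned
      ...   | inj₁ ind′ = ⊥-elim (maximal (e , (e∈X , e∉B) , ind′))

    extend : ∀ {B X} → B ⊆ X → RowsIndependent M B → ∃ λ B′ → B ⊆ B′ × IsBasis B′ X
    extend {B} {X} B⊆X ind = extend-within (rank X) B⊆X ind (ℕ.m≤m+n (rank X) ∣ B ∣)

    basis : ∀ X → ∃ λ B → IsBasis B X
    basis X with extend (⊥⊆ {p = X}) ∅-independent
    ... | B , _ , isBasis = B , isBasis

    Spans-trans : ∀ {B X Y} → Spans M B X → Spans M X Y → Spans M B Y
    Spans-trans B⇒X X⇒Y e e∈Y = InSpan-trans M B⇒X (X⇒Y e e∈Y)

    Spans-⊆ : ∀ {X Y} → Y ⊆ X → Spans M X Y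
    Spans-⊆ Y⊆X e e∈Y = row-inSpan M (Y⊆X e∈Y)

    Spans-∪ : ∀ {B X Y} → Spans M B X → Spans M B Y → Spans M B (X ∪ Y)
    Spans-∪ {X = X} {Y} bX bY e e∈ with x∈p∪q⁻ X Y e∈
    ... | inj₁ e∈X = bX e e∈X
    ... | inj₂ e∈Y = bY e e∈Y

    spanning⇒rank≡ : ∀ {X Y} → X ⊆ Y → Spans M X Y → rank X ≡ rank Y
    spanning⇒rank≡ {X} X⊆Y spans with basis X
    ... | B , B⊆X , ind , spansX = ≡.trans (≡.sym (basis-size (B⊆X , ind , spansX)))
                                          (basis-size (X⊆Y ∘ B⊆X , ind , Spans-trans spansX spans))

    rank≤⇒spanning : ∀ {X Y} → X ⊆ Y → rank Y ℕ.≤ rank X → Spans M X Y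
    rank≤⇒spanning {X} X⊆Y r≤ with rank-attained X
    ... | B , B⊆X , ind , r = λ e e∈Y → InSpan-⊆ M B⊆X
      (full-independent-spans (X⊆Y ∘ B⊆X) ind (≡.subst (_ ℕ.≤_) (≡.sym r) r≤) e e∈Y)

    ∈cl⇒inSpan : ∀ {X e} → e ∈ cl X → InSpan M X (M e)
    ∈cl⇒inSpan {X} {e} e∈ = rank≤⇒spanning (p⊆p∪q ⁅ e ⁆)
      (ℕ.≤-reflexive (∈-tabulate⁻ (λ x → rank (X ∪ ⁅ x ⁆) ℕ.≟ rank X) e∈)) e (q⊆p∪q X ⁅ e ⁆ (x∈⁅x⁆ e))

    inSpan⇒∈cl : ∀ {X e} → InSpan M X (M e) → e ∈ cl X
    inSpan⇒∈cl {X} {e} span = ∈-tabulate⁺ (λ x → rank (X ∪ ⁅ x ⁆) ℕ.≟ rank X)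
      (≡.sym (spanning⇒rank≡ (p⊆p∪q ⁅ e ⁆) (Spans-∪ (Spans-⊆ id) λ f f∈ →
        ≡.subst (λ g → InSpan M X (M g)) (≡.sym (x∈⁅y⁆⇒x≡y e f∈)) span)))

    coefficients-unique : ∀ {Y a b} → RowsIndependent M Y → Supported Y a → Supported Y b →
      (∀ j → combination a M j ≈ combination b M j) → ∀ e → a e ≈ b e
    coefficients-unique {Y} {a} {b} ind a-supp b-supp eq e = begin
      a e                     ≈⟨ +-identityʳ _ ⟨
      a e + 0#                ≈⟨ +-congˡ (-‿inverseˡ (b e)) ⟨
      a e + (- b e + b e)     ≈⟨ +-assoc _ _ _ ⟨
      (a e + - b e) + b e     ≈⟨ +-congʳ (+-congˡ (-1*x≈-x (b e))) ⟨
      (a e + - 1# * b e) + b e ≈⟨ +-congʳ (ind (λ f → a f + - 1# * b f) supp sums e) ⟩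
      0# + b e                ≈⟨ +-identityˡ _ ⟩
      b e                     ∎
      where
      supp : Supported Y (λ f → a f + - 1# * b f)
      supp f f∉ = trans (+-cong (a-supp f f∉) (trans (*-congˡ (b-supp f f∉)) (zeroʳ _))) (+-identityʳ 0#)
      sums : ∀ j → combination (λ f → a f + - 1# * b f) M j ≈ 0#
      sums j = begin
        combination (λ f → a f + - 1# * b f) M j                ≈⟨ combination-+ a (λ f → - 1# * b f) M j ⟩
        combination a M j + combination (λ f → - 1# * b f) M j  ≈⟨ +-cong (eq j) (trans (combination-* (- 1#) b M j) (-1*x≈-x _)) ⟩
        combination b M j - combination b M j                   ≈⟨ -‿inverseʳ _ ⟩
        0#                                                      ∎

    independent⇒∉span : ∀ {B Y e} → RowsIndependent M Y → B ⊆ Y → e ∈ Y → e ∉ B → ¬ InSpan M B (M e)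
    independent⇒∉span {e = e} ind B⊆Y e∈Y e∉B (b , b-supp , b-sums) = 1≉0 (trans (sym (δ-≡ e)) (trans
      (coefficients-unique ind (δ-supported e∈Y) (Supported-⊆ B⊆Y b-supp)
        (λ j → trans (sum-δ e (λ f → M f j)) (sym (b-sums j))) e)
      (b-supp e e∉B)))

    -- Extend a basis `B` of `X ∩ Y` to bases `BX` and `BY`. A relation on `BX ∪ (BY ─ B)` splits
    -- into two parts that cancel, so either part lies in both spans, hence in the span of `B`, and
    -- independence of `BY` kills it. The hypothesis has to speak of all vectors and not only of
    -- rows: two lines through disjoint pairs of four coplanar points share a vector but no row.
    rank-modular : ∀ {X Y} →
      (∀ v → InSpan M X v → InSpan M Y v → InSpan M (X ∩ Y) v) →
      rank (X ∩ Y) ℕ.+ rank (X ∪ Y) ≡ rank X ℕ.+ rank Y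
    rank-modular {X} {Y} meet with basis (X ∩ Y)
    ... | B , B⊆ , B-ind , B-spans with extend (p∩q⊆p X Y ∘ B⊆) B-ind | extend (p∩q⊆q X Y ∘ B⊆) B-ind
    ...   | BX , B⊆BX , BX⊆X , BX-ind , BX-spans | BY , B⊆BY , BY⊆Y , BY-ind , BY-spans = counts
      where
      Q : Subset m
      Q = BY ─ B

      ∈Q⇒∉B : ∀ {e} → e ∈ Q → e ∉ B
      ∈Q⇒∉B = x∈p─q⇒x∉q BY B

      Q⊆BY : Q ⊆ BY
      Q⊆BY = p─q⊆p BY B

      BY⊆Q∪B : BY ⊆ B ∪ Q
      BY⊆Q∪B {e} e∈BY with e ∈? B
      ... | yes e∈B = p⊆p∪q Q e∈B
      ... | no  e∉B = q⊆p∪q B Q (x∈p∧x∉q⇒x∈p─q e∈BY e∉B)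

      module _ (a : Fin m → Carrier) (supp : Supported (BX ∪ Q) a) (sums : ∀ j → combination a M j ≈ 0#) where
        aX aY : Fin m → Carrier
        aX e with e ∈? BX
        ... | yes _ = a e
        ... | no  _ = 0#
        aY e with e ∈? BX
        ... | yes _ = 0#
        ... | no  _ = a e

        aX-supp : Supported BX aX
        aX-supp e e∉ with e ∈? BX
        ... | yes e∈ = ⊥-elim (e∉ e∈)
        ... | no  _  = refl

        aY-supp : Supported Q aY
        aY-supp e e∉ with e ∈? BX
        ... | yes _  = refl
        ... | no e∉X = supp e λ e∈ → [ e∉X , e∉ ]′ (x∈p∪q⁻ BX Q e∈)

        a-split : ∀ e → aX e + aY e ≈ a e
        a-split e with e ∈? BX
        ... | yes _ = +-identityʳ _
        ... | no  _ = +-identityˡ _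

        sums′ : ∀ j → combination aX M j + combination aY M j ≈ 0#
        sums′ j = trans (sym (combination-+ aX aY M j)) (trans (∑-cong λ e → *-congʳ (a-split e)) (sums j))

        v-in-X : InSpan M X (combination aY M)
        v-in-X = (λ e → - 1# * aX e)
          , (λ e e∉ → trans (*-congˡ (aX-supp e (e∉ ∘ BX⊆X))) (zeroʳ _))
          , λ j → trans (trans (combination-* (- 1#) aX M j) (-1*x≈-x _))
                        (sym (+-inverseʳ-unique _ _ (sums′ j)))

        v-in-B : InSpan M B (combination aY M)
        v-in-B = InSpan-trans M B-spans (meet _ v-in-X (aY , Supported-⊆ (BY⊆Y ∘ Q⊆BY) aY-supp , λ j → refl))

        aY≈0 : ∀ e → aY e ≈ 0#
        aY≈0 e with e ∈? Q
        ... | no e∉Q = aY-supp e e∉Q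
        ... | yes e∈Q with v-in-B
        ...   | b , b-supp , b-sums = trans
          (coefficients-unique BY-ind (Supported-⊆ Q⊆BY aY-supp) (Supported-⊆ B⊆BY b-supp) (λ j → sym (b-sums j)) e)
          (b-supp e (∈Q⇒∉B e∈Q))

        aX≈0 : ∀ e → aX e ≈ 0#
        aX≈0 = BX-ind aX aX-supp λ j → trans (sym (+-identityʳ _))
          (trans (+-congˡ (sym (sum-≈0 {m} _ λ e → trans (*-congʳ (aY≈0 e)) (zeroˡ _)))) (sums′ j))

        a≈0 : ∀ e → a e ≈ 0#
        a≈0 e = trans (sym (a-split e)) (trans (+-cong (aX≈0 e) (aY≈0 e)) (+-identityʳ 0#))

      -- A common row would lie in `X ∩ Y`, hence in the span of `B`, although it belongs to the
      -- independent `BY` outside `B`.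
      disjoint : Empty (BX ∩ Q)
      disjoint (e , e∈) with x∈p∩q⁻ BX Q e∈
      ... | e∈BX , e∈Q = independent⇒∉span BY-ind B⊆BY (Q⊆BY e∈Q) (∈Q⇒∉B e∈Q)
        (B-spans e (x∈p∩q⁺ (BX⊆X e∈BX , BY⊆Y (Q⊆BY e∈Q))))

      union-basis : IsBasis (BX ∪ Q) (X ∪ Y)
      union-basis = ∪-least (p⊆p∪q Y ∘ BX⊆X) (q⊆p∪q X Y ∘ BY⊆Y ∘ Q⊆BY)
        , a≈0
        , Spans-∪ (Spans-trans (Spans-⊆ (p⊆p∪q Q)) BX-spans)
                  (Spans-trans (Spans-⊆ (∪-least (p⊆p∪q Q ∘ B⊆BX) (q⊆p∪q BX Q) ∘ BY⊆Q∪B)) BY-spans)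

      ∣BY∣≡ : ∣ BY ∣ ≡ ∣ B ∣ ℕ.+ ∣ Q ∣
      ∣BY∣≡ = ≡.trans (≡.cong ∣_∣ (⊆-antisym BY⊆Q∪B (∪-least B⊆BY Q⊆BY)))
        (∣p∪q∣≡∣p∣+∣q∣ B Q λ (e , e∈) → ∈Q⇒∉B (proj₂ (x∈p∩q⁻ B Q e∈)) (proj₁ (x∈p∩q⁻ B Q e∈)))

      counts : rank (X ∩ Y) ℕ.+ rank (X ∪ Y) ≡ rank X ℕ.+ rank Y
      counts = begin≡
        rank (X ∩ Y) ℕ.+ rank (X ∪ Y)       ≡⟨ ≡.cong₂ ℕ._+_ (basis-size (B⊆ , B-ind , B-spans)) (basis-size union-basis) ⟨
        ∣ B ∣ ℕ.+ ∣ BX ∪ Q ∣                ≡⟨ ≡.cong (∣ B ∣ ℕ.+_) (∣p∪q∣≡∣p∣+∣q∣ BX Q disjoint) ⟩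
        ∣ B ∣ ℕ.+ (∣ BX ∣ ℕ.+ ∣ Q ∣)        ≡⟨ solve 3 (λ b x q → b :+ (x :+ q) := x :+ (b :+ q)) ≡.refl (∣ B ∣) (∣ BX ∣) (∣ Q ∣) ⟩
        ∣ BX ∣ ℕ.+ (∣ B ∣ ℕ.+ ∣ Q ∣)        ≡⟨ ≡.cong (∣ BX ∣ ℕ.+_) ∣BY∣≡ ⟨
        ∣ BX ∣ ℕ.+ ∣ BY ∣                   ≡⟨ ≡.cong₂ ℕ._+_ (basis-size (BX⊆X , BX-ind , BX-spans)) (basis-size (BY⊆Y , BY-ind , BY-spans)) ⟩
        rank X ℕ.+ rank Y                   ∎≡
        where
        open ≡.≡-Reasoning renaming (begin_ to begin≡_; _∎ to _∎≡)

-- Arithmetic of polynomials and its evaluation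

constant : ∀ N → ℚ → Polynomial N
constant zero    q = q
constant (suc N) q = constant N q ∷ []

indeterminate : ∀ {N} → Fin N → Polynomial N
indeterminate {suc N} zero    = constant N 0ℚ ∷ constant N 1ℚ ∷ []
indeterminate {suc N} (suc i) = indeterminate i ∷ []

-- Coefficient lists are not normalised: only values under `eval` matter, and `IsZero` tolerates
-- zero coefficients at the end.
add : ∀ N → Polynomial N → Polynomial N → Polynomial N
add zero    p       q       = p ℚ.+ q
add (suc N) []      g       = g
add (suc N) (a ∷ f) []      = a ∷ f
add (suc N) (a ∷ f) (b ∷ g) = add N a b ∷ add (suc N) f g

multiply : ∀ N → Polynomial N → Polynomial N → Polynomial N
multiply zero    p       q = p ℚ.* q
multiply (suc N) []      g = []
multiply (suc N) (a ∷ f) g =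
  add (suc N) (List.map (multiply N a) g) (constant N 0ℚ ∷ multiply (suc N) f g)

module Evaluation {c ℓ₁ ℓ₂} (K : HeytingField c ℓ₁ ℓ₂) (ι : ℚ → HeytingField.Carrier K)
                  (ι-hom : IsRingHomomorphism +-*-rawRing (rawRing K) ι) where
  open HeytingField K hiding (setoid; zero)
  open Genericity K ι
  open IsRingHomomorphism ι-hom using (+-homo; *-homo; 0#-homo; 1#-homo)
  open CommutativeRing (ring K) using (setoid; +-commutativeSemigroup; *-commutativeSemigroup)
  open import Algebra.Properties.CommutativeSemigroup +-commutativeSemigroup using (interchange)
  open import Algebra.Properties.CommutativeSemigroup *-commutativeSemigroup using (x∙yz≈y∙xz)
  open import Relation.Binary.Reasoning.Setoid setoid

  eval-constant : ∀ N q x → eval N (constant N q) x ≈ ι q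
  eval-constant zero    q x = refl
  eval-constant (suc N) q x = trans (+-cong (eval-constant N q (x ∘ suc)) (zeroʳ (x zero))) (+-identityʳ (ι q))

  eval-indeterminate : ∀ {N} (i : Fin N) x → eval N (indeterminate i) x ≈ x i
  eval-indeterminate {suc N} zero x = begin
    eval N (constant N 0ℚ) (x ∘ suc) + x zero * (eval N (constant N 1ℚ) (x ∘ suc) + x zero * 0#)
      ≈⟨ +-cong (trans (eval-constant N 0ℚ (x ∘ suc)) 0#-homo)
                (*-congˡ (+-cong (trans (eval-constant N 1ℚ (x ∘ suc)) 1#-homo) (zeroʳ _))) ⟩
    0# + x zero * (1# + 0#)  ≈⟨ +-identityˡ _ ⟩
    x zero * (1# + 0#)       ≈⟨ *-congˡ (+-identityʳ 1#) ⟩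
    x zero * 1#              ≈⟨ *-identityʳ _ ⟩
    x zero                   ∎
  eval-indeterminate {suc N} (suc i) x =
    trans (+-cong (eval-indeterminate i (x ∘ suc)) (zeroʳ (x zero))) (+-identityʳ _)

  eval-add : ∀ N f g x → eval N (add N f g) x ≈ eval N f x + eval N g x
  eval-add zero    p       q       x = +-homo p q
  eval-add (suc N) []      g       x = sym (+-identityˡ _)
  eval-add (suc N) (a ∷ f) []      x = sym (+-identityʳ _)
  eval-add (suc N) (a ∷ f) (b ∷ g) x = begin
    eval N (add N a b) (x ∘ suc) + x zero * eval (suc N) (add (suc N) f g) x
      ≈⟨ +-cong (eval-add N a b (x ∘ suc)) (trans (*-congˡ (eval-add (suc N) f g x)) (distribˡ _ _ _)) ⟩
    (eval N a (x ∘ suc) + eval N b (x ∘ suc)) + (x zero * eval (suc N) f x + x zero * eval (suc N) g x)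
      ≈⟨ interchange _ _ _ _ ⟩
    eval (suc N) (a ∷ f) x + eval (suc N) (b ∷ g) x ∎

  eval-multiply : ∀ N f g x → eval N (multiply N f g) x ≈ eval N f x * eval N g x
  eval-scale : ∀ N a g x → eval (suc N) (List.map (multiply N a) g) x ≈ eval N a (x ∘ suc) * eval (suc N) g x

  eval-multiply zero    p       q x = *-homo p q
  eval-multiply (suc N) []      g x = sym (zeroˡ _)
  eval-multiply (suc N) (a ∷ f) g x = begin
    eval (suc N) (add (suc N) (List.map (multiply N a) g) (constant N 0ℚ ∷ multiply (suc N) f g)) x
      ≈⟨ eval-add (suc N) (List.map (multiply N a) g) _ x ⟩
    eval (suc N) (List.map (multiply N a) g) x + (eval N (constant N 0ℚ) (x ∘ suc) + x zero * eval (suc N) (multiply (suc N) f g) x)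
      ≈⟨ +-cong (eval-scale N a g x) (+-cong (trans (eval-constant N 0ℚ (x ∘ suc)) 0#-homo) (*-congˡ (eval-multiply (suc N) f g x))) ⟩
    eval N a (x ∘ suc) * eval (suc N) g x + (0# + x zero * (eval (suc N) f x * eval (suc N) g x))
      ≈⟨ +-congˡ (trans (+-identityˡ _) (sym (*-assoc _ _ _))) ⟩
    eval N a (x ∘ suc) * eval (suc N) g x + x zero * eval (suc N) f x * eval (suc N) g x
      ≈⟨ distribʳ _ _ _ ⟨
    eval (suc N) (a ∷ f) x * eval (suc N) g x ∎

  eval-scale N a []      x = sym (zeroʳ _)
  eval-scale N a (b ∷ g) x = begin
    eval N (multiply N a b) (x ∘ suc) + x zero * eval (suc N) (List.map (multiply N a) g) x
      ≈⟨ +-cong (eval-multiply N a b (x ∘ suc)) (trans (*-congˡ (eval-scale N a g x)) (x∙yz≈y∙xz _ _ _)) ⟩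
    eval N a (x ∘ suc) * eval N b (x ∘ suc) + eval N a (x ∘ suc) * (x zero * eval (suc N) g x)
      ≈⟨ distribˡ _ _ _ ⟨
    eval N a (x ∘ suc) * eval (suc N) (b ∷ g) x ∎

  eval-IsZero : ∀ N {f} x → IsZero N f → eval N f x ≈ 0#
  eval-IsZero zero    x ≡.refl  = 0#-homo
  eval-IsZero (suc N) x []      = refl
  eval-IsZero (suc N) x (z ∷ zs) = trans
    (+-cong (eval-IsZero N (x ∘ suc) z) (trans (*-congˡ (eval-IsZero (suc N) x zs)) (zeroʳ _)))
    (+-identityʳ 0#)

-- Fraction-free elimination and affinely independent points

module GenericPosition {c ℓ₁ ℓ₂} (K : HeytingField c ℓ₁ ℓ₂) (_#?_ : Decidable (HeytingField._#_ K)) where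
  open HeytingField K hiding (setoid; zero)
  open CommutativeRing (ring K) using (setoid; *-commutativeSemigroup)
  open LinearAlgebra K _#?_ hiding (x∉p-x)
  open LinearSpan K _#?_
  open import Algebra.Properties.CommutativeSemigroup *-commutativeSemigroup using (x∙yz≈y∙xz)
  open import Algebra.Properties.Semiring.Sum (CommutativeRing.semiring (ring K)) using (*-distribˡ-sum)
  open import Algebra.Properties.Ring (CommutativeRing.ring (ring K)) using (-‿distribˡ-*; -‿distribʳ-*; -1*x≈-x)
  open import Relation.Binary.Reasoning.Setoid setoid

  combination-scale : ∀ {m N s} {M M₁ : Matrix m N} → (∀ e j → M₁ e j ≈ s * M e j) →
    ∀ a j → combination a M₁ j ≈ s * combination a M j
  combination-scale {s = s} {M} eq a j = trans
    (∑-cong λ e → trans (*-congˡ (eq e j)) (x∙yz≈y∙xz _ _ _))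
    (sym (*-distribˡ-sum s (λ e → a e * M e j)))

  scale-independent : ∀ {m N s} {M M₁ : Matrix m N} {Y} → (∀ e j → M₁ e j ≈ s * M e j) → ¬ s ≈ 0# →
    RowsIndependent M Y → RowsIndependent M₁ Y
  scale-independent eq s≉0 ind a supp sums = ind a supp λ j →
    x*y≈0⇒y≈0 s≉0 (trans (sym (combination-scale eq a j)) (sums j))

  unscale-independent : ∀ {m N s} {M M₁ : Matrix m N} {Y} → (∀ e j → M₁ e j ≈ s * M e j) →
    RowsIndependent M₁ Y → RowsIndependent M Y
  unscale-independent eq ind a supp sums = ind a supp λ j →
    trans (combination-scale eq a j) (trans (*-congˡ (sums j)) (zeroʳ _))

  -- One elimination step cleared of its denominator: the left side is the 2 by 2 minor s x - z w, a
  -- polynomial in the entries, and the right side is the pivot s times the entry obtained by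
  -- division. The minus sign is a factor - 1 because polynomials are given only constants,
  -- indeterminates, sums and products.
  fraction-free : ∀ {s y} x z w → y * s ≈ 1# → s * x + - 1# * (z * w) ≈ s * (x + - (z * y) * w)
  fraction-free {s} {y} x z w ys≈1 = begin
    s * x + - 1# * (z * w)          ≈⟨ +-congˡ (-1*x≈-x _) ⟩
    s * x + - (z * w)               ≈⟨ +-congˡ (-‿cong (*-congʳ lemma)) ⟩
    s * x + - (s * (z * y) * w)     ≈⟨ +-congˡ (-‿cong (*-assoc _ _ _)) ⟩
    s * x + - (s * (z * y * w))     ≈⟨ +-congˡ (-‿distribʳ-* _ _) ⟩
    s * x + s * - (z * y * w)       ≈⟨ +-congˡ (*-congˡ (-‿distribˡ-* _ _)) ⟩
    s * x + s * (- (z * y) * w)     ≈⟨ distribˡ _ _ _ ⟨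
    s * (x + - (z * y) * w)         ∎
    where
    lemma : z ≈ s * (z * y)
    lemma = begin
      z            ≈⟨ *-identityʳ z ⟨
      z * 1#       ≈⟨ *-congˡ (trans (*-comm s y) ys≈1) ⟨
      z * (s * y)  ≈⟨ x∙yz≈y∙xz _ _ _ ⟩
      s * (z * y)  ∎

  -- The extra coordinate 1 makes linear dependence of rows the same as affine dependence of points.
  homogenise : ∀ {n d} → (Fin n → Fin d → Carrier) → Matrix n (suc d)
  homogenise p u zero    = 1#
  homogenise p u (suc i) = p u i

  zero-row : ∀ {n D} → Matrix n D → Matrix (suc n) D
  zero-row q zero    _ = 0#
  zero-row q (suc u) j = q u j

  unit-row : ∀ {n D} → Matrix n D → Matrix (suc n) (suc D)
  unit-row q zero    zero    = 1#
  unit-row q zero    (suc _) = 0#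
  unit-row q (suc u) zero    = 0#
  unit-row q (suc u) (suc j) = q u j

  independent-vectors : ∀ {n} D (I : Subset n) → ∣ I ∣ ℕ.≤ D →
    ∃ λ (q : Matrix n D) → RowsIndependent q I
  independent-vectors D Vec.[] _ = (λ ()) , λ _ _ _ ()
  independent-vectors D (outside Vec.∷ I) I≤D with independent-vectors D I I≤D
  ... | q , ind = zero-row q , λ where
    a supp sums zero    → supp zero λ ()
    a supp sums (suc u) → ind (a ∘ suc) (λ v v∉ → supp (suc v) (v∉ ∘ drop-there))
      (λ j → trans (sym (+-identityˡ _)) (trans (+-congʳ (sym (zeroʳ (a zero)))) (sums j))) u
  independent-vectors {suc n} (suc D) (inside Vec.∷ I) (s≤s I≤D) with independent-vectors D I I≤D
  ... | q , ind = unit-row q , λ where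
    a supp sums zero    → trans (sym (*-identityʳ _)) (trans (sym (+-identityʳ _))
      (trans (+-congˡ (sym (sum-≈0 {n} _ λ u → zeroʳ (a (suc u))))) (sums zero)))
    a supp sums (suc u) → ind (a ∘ suc) (λ v v∉ → supp (suc v) (v∉ ∘ drop-there))
      (λ j → trans (sym (+-identityˡ _)) (trans (+-congʳ (sym (zeroʳ (a zero)))) (sums (suc j)))) u

  -- The first member of `I` goes to the origin and the others to distinct unit vectors, which gives
  -- vertices of a standard simplex. The coordinates kill all coefficients but the one at the
  -- origin, and the homogenising column kills that one.
  affinely-independent-points : ∀ {n} d (I : Subset n) → ∣ I ∣ ℕ.≤ suc d →
    ∃ λ (q : Fin n → Fin d → Carrier) → RowsIndependent (homogenise q) I
  affinely-independent-points d Vec.[] _ = (λ ()) , λ _ _ _ ()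
  affinely-independent-points d (outside Vec.∷ I) I≤d with affinely-independent-points d I I≤d
  ... | q , ind = zero-row q , λ where
    a supp sums zero    → supp zero λ ()
    a supp sums (suc u) → ind (a ∘ suc) (λ v v∉ → supp (suc v) (v∉ ∘ drop-there)) (λ where
      zero    → trans (sym (+-identityˡ _))
        (trans (+-congʳ (sym (trans (*-identityʳ _) (supp zero λ ())))) (sums zero))
      (suc j) → trans (sym (+-identityˡ _)) (trans (+-congʳ (sym (zeroʳ (a zero)))) (sums (suc j)))) u
  affinely-independent-points {suc n} d (inside Vec.∷ I) (s≤s I≤d) with independent-vectors d I I≤d
  ... | q , ind = zero-row q , affine
    where
    tail-≈0 : ∀ a → Supported (inside Vec.∷ I) a → (∀ j → combination a (homogenise (zero-row q)) j ≈ 0#) →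
      ∀ u → a (suc u) ≈ 0#
    tail-≈0 a supp sums = ind (a ∘ suc) (λ v v∉ → supp (suc v) (v∉ ∘ drop-there))
      (λ j → trans (sym (+-identityˡ _)) (trans (+-congʳ (sym (zeroʳ (a zero)))) (sums (suc j))))

    affine : RowsIndependent (homogenise (zero-row q)) (inside Vec.∷ I)
    affine a supp sums (suc u) = tail-≈0 a supp sums u
    affine a supp sums zero    = trans (sym (*-identityʳ _)) (trans (sym (+-identityʳ _)) (trans
      (+-congˡ (sym (sum-≈0 {n} _ λ u → trans (*-congʳ (tail-≈0 a supp sums u)) (zeroˡ 1#)))) (sums zero)))

-- Transfer of independence from a rational point to a generic one

ℚ-#? : Decidable (HeytingField._#_ ℚ.heytingField)
ℚ-#? x y = ¬? (x ℚ.≟ y)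

ℚ-id-hom : IsRingHomomorphism +-*-rawRing (rawRing ℚ.heytingField) id
ℚ-id-hom = isRingHomomorphism +-*-rawRing ≡.refl

module Specialisation {c ℓ₁ ℓ₂} (K : HeytingField c ℓ₁ ℓ₂) (_#?_ : Decidable (HeytingField._#_ K))
    (ι : ℚ → HeytingField.Carrier K) (ι-hom : IsRingHomomorphism +-*-rawRing (rawRing K) ι) where
  open HeytingField K hiding (setoid; zero)
  open Genericity K ι
  open IsRingHomomorphism ι-hom using (1#-homo; -‿homo)
  open GenericPosition K _#?_
  open LinearAlgebra K _#?_ using (RowsIndependent; inverse; module Pivot)
  open LinearSpan K _#?_ using (∑-cong)
  private
    module Q  = Evaluation ℚ.heytingField id ℚ-id-hom
    module QG = Genericity ℚ.heytingField id
    module QL = LinearAlgebra ℚ.heytingField ℚ-#?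
    module QS = LinearSpan ℚ.heytingField ℚ-#?
    module QP = GenericPosition ℚ.heytingField ℚ-#?
    module E  = Evaluation K ι ι-hom

  module _ {N} {x : Fin N → Carrier} (x-independent : AlgebraicallyIndependent x) (q : Fin N → ℚ) where

    eval-≉0 : ∀ {f} → QG.eval N f q ≢ 0ℚ → ¬ eval N f x ≈ 0#
    eval-≉0 f[q]≢0 f[x]≈0 = f[q]≢0 (Q.eval-IsZero N q (x-independent _ f[x]≈0))

    -- Fraction-free elimination, with pivots chosen at the rational point q:
    -- each is a polynomial that does not vanish at q, hence not at x.
    specialise-independent : ∀ {m M} (P : Fin m → Fin M → Polynomial N) (Y : Subset m) →
      QL.RowsIndependent (λ e j → QG.eval N (P e j) q) Y → RowsIndependent (λ e j → eval N (P e j) x) Y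
    specialise-independent {M = zero} P Y ind with nonempty? Y
    ... | no empty = λ a supp _ e → supp e λ e∈Y → empty (e , e∈Y)
    ... | yes (e , e∈Y) = ⊥-elim (QS.1≉0 (≡.trans (≡.sym (QL.δ-≡ e)) (ind (QL.δ e) (QS.δ-supported e∈Y) (λ ()) e)))
    specialise-independent {m} {suc M} P Y ind
      with any? (λ e → (e ∈? Y) ×-dec ¬? (QG.eval N (P e zero) q QL.≈0?))
    ... | no ¬pivot = λ a supp sums → specialise-independent (λ e j → P e (suc j)) Y
      (λ a supp sums → ind a supp λ where
        zero    → QL.sum-≈0 {m} _ (QS.supported-*≈0 supp (QS.column0-≈0 {M = λ e j → QG.eval N (P e j) q} ¬pivot))
        (suc j) → sums j) a supp (sums ∘ suc)
    ... | yes (e , e∈Y , f[q]≢0) with QL.inverse f[q]≢0 | inverse (eval-≉0 {P e zero} f[q]≢0)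
    -- Down one column over ℚ, then back up over `K`: at either point the matrix of minors is the
    -- eliminated matrix times the pivot.
    ...   | y , ys≡1 | z , zs≈1 = KPivot.to (unscale-independent {Y = Y ∖ e} K-eq
      (specialise-independent P′ (Y ∖ e) (QP.scale-independent {Y = Y ∖ e} Q-eq f[q]≢0 (QPivot.from ind))))
      where
      module QPivot = QL.Pivot (λ e j → QG.eval N (P e j) q) Y e e∈Y y ys≡1
      module KPivot = Pivot (λ e j → eval N (P e j) x) Y e e∈Y z zs≈1

      P′ : Fin m → Fin M → Polynomial N
      P′ f j = add N (multiply N (P e zero) (P f (suc j)))
                     (multiply N (constant N (ℚ.- 1ℚ)) (multiply N (P f zero) (P e (suc j))))

      Q-eq : ∀ f j → QG.eval N (P′ f j) q ≡ QG.eval N (P e zero) q ℚ.* QPivot.M′ f j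
      Q-eq f j = ≡.trans (Q.eval-add N _ _ q) (≡.trans
        (≡.cong₂ ℚ._+_ (Q.eval-multiply N (P e zero) (P f (suc j)) q)
          (≡.trans (Q.eval-multiply N (constant N (ℚ.- 1ℚ)) _ q)
            (≡.cong₂ ℚ._*_ (Q.eval-constant N (ℚ.- 1ℚ) q) (Q.eval-multiply N (P f zero) (P e (suc j)) q))))
        (QP.fraction-free {QG.eval N (P e zero) q} {y} (QG.eval N (P f (suc j)) q) (QG.eval N (P f zero) q) (QG.eval N (P e (suc j)) q) ys≡1))

      K-eq : ∀ f j → eval N (P′ f j) x ≈ eval N (P e zero) x * KPivot.M′ f j
      K-eq f j = trans (E.eval-add N _ _ x) (trans
        (+-cong (E.eval-multiply N (P e zero) (P f (suc j)) x)
          (trans (E.eval-multiply N (constant N (ℚ.- 1ℚ)) _ x)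
            (*-cong (trans (E.eval-constant N (ℚ.- 1ℚ) x) (trans (-‿homo 1ℚ) (-‿cong 1#-homo)))
                    (E.eval-multiply N (P f zero) (P e (suc j)) x))))
        (fraction-free _ (eval N (P f zero) x) _ zs≈1))

  -- The entries 1 and the coordinate indeterminates evaluate to `homogenise` at both
  -- configurations, so one affinely independent rational configuration settles `I`. It may be a
  -- different one for each `I`.
  generic-independent : ∀ {n d} {p : Fin n → Fin d → Carrier} → Generic p →
    ∀ I → ∣ I ∣ ℕ.≤ suc d → RowsIndependent (homogenise p) I
  generic-independent {n} {d} {p} generic I I≤ with QP.affinely-independent-points d I I≤
  ... | q , ind = λ a supp sums → specialise-independent generic (λ j → uncurry q (remQuot {n} d j)) P I
      (λ a supp sums → ind a supp λ j → ≡.trans (QS.∑-cong λ u → ≡.cong (a u ℚ.*_) (≡.sym (Q-eq u j))) (sums j))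
      a supp λ j → trans (∑-cong λ u → *-congˡ (K-eq u j)) (sums j)
    where
    P : Fin n → Fin (suc d) → Polynomial (n ℕ.* d)
    P u zero    = constant (n ℕ.* d) 1ℚ
    P u (suc i) = indeterminate (combine u i)

    Q-eq : ∀ u j → QG.eval (n ℕ.* d) (P u j) (λ j → uncurry q (remQuot {n} d j)) ≡ QP.homogenise q u j
    Q-eq u zero    = Q.eval-constant (n ℕ.* d) 1ℚ _
    Q-eq u (suc i) = ≡.trans (Q.eval-indeterminate (combine u i) _) (≡.cong (uncurry q) (remQuot-combine u i))

    K-eq : ∀ u j → eval (n ℕ.* d) (P u j) (λ j → uncurry p (remQuot {n} d j)) ≈ homogenise p u j
    K-eq u zero    = trans (E.eval-constant (n ℕ.* d) 1ℚ _) 1#-homo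
    K-eq u (suc i) = trans (E.eval-indeterminate (combine u i) _) (reflexive (≡.cong (uncurry p) (remQuot-combine u i)))

-- Edges and vertex sets of complete graphs

lookup-injective : ∀ {a} {A : Set a} {xs : List A} → Unique xs →
  ∀ i j → List.lookup xs i ≡ List.lookup xs j → i ≡ j
lookup-injective (_ ∷ _)  zero    zero    _  = ≡.refl
lookup-injective (x≢ ∷ _) zero    (suc j) eq = ⊥-elim (All.lookup x≢ (∈-lookup j) eq)
lookup-injective (x≢ ∷ _) (suc i) zero    eq = ⊥-elim (All.lookup x≢ (∈-lookup i) (≡.sym eq))
lookup-injective (_ ∷ u)  (suc i) (suc j) eq = ≡.cong suc (lookup-injective u i j eq)

module Edges (n : ℕ) where

  fst snd : Fin ∣K n ∣ → Fin n
  fst e = proj₁ (ends {n} e)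
  snd e = proj₂ (ends {n} e)

  fst<snd : ∀ e → fst e < snd e
  fst<snd e = proj₂ (∈-filter⁻ (λ (u , v) → u <ᶠ? v) {xs = cartesianProduct (allFin n) (allFin n)} (∈-lookup e))

  ends-injective : ∀ e f → ends {n} e ≡ ends f → e ≡ f
  ends-injective = lookup-injective
    (Unique.filter⁺ (λ (u , v) → u <ᶠ? v) (Unique.cartesianProduct⁺ (Unique.allFin⁺ n) (Unique.allFin⁺ n)))

  edge : ∀ {u v : Fin n} → u < v → ∃ λ e → ends {n} e ≡ (u , v)
  edge {u} {v} u<v = Any.index uv∈ , ≡.sym (lookup-index uv∈)
    where
    uv∈ : (u , v) ∈ˡ edges n
    uv∈ = ∈-filter⁺ (λ (u , v) → u <ᶠ? v) (∈-cartesianProduct⁺ (∈-allFin u) (∈-allFin v)) u<v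

  complete : Subset n → EdgeSet n
  complete U = Vec.tabulate λ e → ⌊ (fst e ∈? U) ×-dec (snd e ∈? U) ⌋

  ∈-complete⁺ : ∀ {U e} → fst e ∈ U → snd e ∈ U → e ∈ complete U
  ∈-complete⁺ {U} e₁∈ e₂∈ = ∈-tabulate⁺ (λ e → (fst e ∈? U) ×-dec (snd e ∈? U)) (e₁∈ , e₂∈)

  ∈-complete⁻ : ∀ {U e} → e ∈ complete U → fst e ∈ U × snd e ∈ U
  ∈-complete⁻ {U} = ∈-tabulate⁻ (λ e → (fst e ∈? U) ×-dec (snd e ∈? U))

  complete-∩ : ∀ U W → complete U ∩ complete W ≡ complete (U ∩ W)
  complete-∩ U W = ⊆-antisym
    (λ e∈ → let e∈U , e∈W = x∈p∩q⁻ (complete U) (complete W) e∈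
                u₁ , u₂ = ∈-complete⁻ {U} e∈U ; w₁ , w₂ = ∈-complete⁻ {W} e∈W
            in ∈-complete⁺ (x∈p∩q⁺ (u₁ , w₁)) (x∈p∩q⁺ (u₂ , w₂)))
    (λ e∈ → let e₁∈ , e₂∈ = ∈-complete⁻ {U ∩ W} e∈
                u₁ , w₁ = x∈p∩q⁻ U W e₁∈ ; u₂ , w₂ = x∈p∩q⁻ U W e₂∈
            in x∈p∩q⁺ (∈-complete⁺ {U} u₁ u₂ , ∈-complete⁺ {W} w₁ w₂))

  complete-⊆ : ∀ {U W} → U ⊆ W → complete U ⊆ complete W
  complete-⊆ {U} U⊆W e∈ = let e₁∈ , e₂∈ = ∈-complete⁻ {U} e∈ in ∈-complete⁺ (U⊆W e₁∈) (U⊆W e₂∈)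

-- Row combinations as symmetric stresses

module CompleteSpans {c ℓ₁ ℓ₂} (K : HeytingField c ℓ₁ ℓ₂) (_#?_ : Decidable (HeytingField._#_ K))
    {n d : ℕ} (p : Fin n → Fin d → HeytingField.Carrier K) where
  open HeytingField K hiding (setoid; zero)
  open CommutativeRing (ring K) using (setoid; semiring)
  open LinearAlgebra K _#?_ hiding (x∉p-x)
  open LinearSpan K _#?_
  open LinearRank K _#?_
  open Rigidity K _#?_ p
  open Edges n
  open import Algebra.Properties.Semiring.Sum semiring using (sum; ∑-distrib-+; *-distribˡ-sum)
  open import Relation.Binary.Reasoning.Setoid setoid using (begin_; step-≈-⟩; step-≈-⟨; _∎)

  diff : Fin n → Fin n → Fin d → Carrier
  diff w u i = p w i - p u i

  diff-self : ∀ w i → diff w w i ≈ 0#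
  diff-self w i = -‿inverseʳ (p w i)

  diff-+-p : ∀ w u i → diff w u i + p u i ≈ p w i
  diff-+-p w u i = trans (+-assoc _ _ _) (trans (+-congˡ (-‿inverseˡ _)) (+-identityʳ _))

  diff-+ : ∀ w v u i → diff w v i + diff v u i ≈ diff w u i
  diff-+ w v u i = trans (sym (+-assoc _ _ _)) (+-congʳ (diff-+-p w v i))

  -- In the language of frameworks, the force at `w` produced by the stress `g`. The diagonal of `g`
  -- does not contribute, because `diff w w` is zero.
  load : (Fin n → Fin n → Carrier) → Fin n → Fin d → Carrier
  load g w i = sum λ u → g w u * diff w u i

  load-+ : ∀ g h w i → load (λ w u → g w u + h w u) w i ≈ load g w i + load h w i
  load-+ g h w i = trans (∑-cong λ u → distribʳ (diff w u i) (g w u) (h w u))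
                         (∑-distrib-+ (λ u → g w u * diff w u i) (λ u → h w u * diff w u i))

  -- The stress with value one on `e` alone, as a symmetric function of ordered pairs: one product
  -- for each order of the ends.
  incidence : Fin ∣K n ∣ → Fin n → Fin n → Carrier
  incidence e w u = δ (fst e) w * δ (snd e) u + δ (snd e) w * δ (fst e) u

  incidence-sym : ∀ e w u → incidence e w u ≈ incidence e u w
  incidence-sym e w u = trans (+-comm _ _) (+-cong (*-comm _ _) (*-comm _ _))

  δ*-≢ : ∀ {m} {e f : Fin m} {x} → f ≢ e → δ e f * x ≈ 0#
  δ*-≢ f≢e = trans (*-congʳ (δ-≢ _ _ f≢e)) (zeroˡ _)

  *δ-≢ : ∀ {m} {e f : Fin m} {x} → f ≢ e → x * δ e f ≈ 0#
  *δ-≢ f≢e = trans (*-congˡ (δ-≢ _ _ f≢e)) (zeroʳ _)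

  incidence-off : ∀ e w u → w ≢ fst e → w ≢ snd e → incidence e w u ≈ 0#
  incidence-off e w u w≢₁ w≢₂ = trans (+-cong (δ*-≢ w≢₁) (δ*-≢ w≢₂)) (+-identityʳ 0#)

  sum-incidence : ∀ e w (t : Fin n → Carrier) →
    sum (λ u → incidence e w u * t u) ≈ δ (fst e) w * t (snd e) + δ (snd e) w * t (fst e)
  sum-incidence e w t = begin
    sum (λ u → incidence e w u * t u)
      ≈⟨ ∑-cong (λ u → trans (distribʳ (t u) (δ (fst e) w * δ (snd e) u) (δ (snd e) w * δ (fst e) u))
                              (+-cong (*-assoc _ (δ (snd e) u) _) (*-assoc _ (δ (fst e) u) _))) ⟩
    sum (λ u → δ (fst e) w * (δ (snd e) u * t u) + δ (snd e) w * (δ (fst e) u * t u))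
      ≈⟨ ∑-distrib-+ (λ u → δ (fst e) w * (δ (snd e) u * t u)) (λ u → δ (snd e) w * (δ (fst e) u * t u)) ⟩
    sum (λ u → δ (fst e) w * (δ (snd e) u * t u)) + sum (λ u → δ (snd e) w * (δ (fst e) u * t u))
      ≈⟨ +-cong (sym (*-distribˡ-sum (δ (fst e) w) (λ u → δ (snd e) u * t u)))
                (sym (*-distribˡ-sum (δ (snd e) w) (λ u → δ (fst e) u * t u))) ⟩
    δ (fst e) w * sum (λ u → δ (snd e) u * t u) + δ (snd e) w * sum (λ u → δ (fst e) u * t u)
      ≈⟨ +-cong (*-congˡ (sum-δ (snd e) t)) (*-congˡ (sum-δ (fst e) t)) ⟩
    δ (fst e) w * t (snd e) + δ (snd e) w * t (fst e) ∎

  entry-incidence : ∀ e w i → entry (ends e) (w , i) ≈ sum (λ u → incidence e w u * diff w u i)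
  entry-incidence e w i = trans (lemma (fst e) (snd e) (<ᶠ⇒≢ (fst<snd e))) (sym (sum-incidence e w (λ u → diff w u i)))
    where
    lemma : ∀ u v → u ≢ v → entry (u , v) (w , i) ≈ δ u w * diff w v i + δ v w * diff w u i
    lemma u v u≢v with w ≟ u | w ≟ v
    ... | yes ≡.refl | _ = sym (trans (+-cong (trans (*-congʳ (δ-≡ u)) (*-identityˡ _)) (δ*-≢ u≢v)) (+-identityʳ _))
    ... | no w≢u | yes ≡.refl = sym (trans (+-cong (δ*-≢ w≢u) (trans (*-congʳ (δ-≡ v)) (*-identityˡ _))) (+-identityˡ _))
    ... | no w≢u | no w≢v = sym (trans (+-cong (δ*-≢ w≢u) (δ*-≢ w≢v)) (+-identityʳ 0#))

  row-incidence : ∀ e w i → rigidityMatrix e (combine w i) ≈ sum (λ u → incidence e w u * diff w u i)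
  row-incidence e w i = trans (reflexive (≡.cong (entry (ends e)) (remQuot-combine w i))) (entry-incidence e w i)

  -- Edge coefficients placed on both orders of the ends. Sums at a vertex then run over all
  -- vertices and ignore the numbering of the edges.
  weight : (Fin ∣K n ∣ → Carrier) → Fin n → Fin n → Carrier
  weight a w u = sum λ e → a e * incidence e w u

  weight-sym : ∀ a w u → weight a w u ≈ weight a u w
  weight-sym a w u = ∑-cong λ e → *-congˡ (incidence-sym e w u)

  combination-load : ∀ a w i → combination a rigidityMatrix (combine w i) ≈ load (weight a) w i
  combination-load a w i = trans (∑-cong λ e → *-congˡ (row-incidence e w i))
    (sym (combination-assoc a (λ e u → incidence e w u) (λ u i → diff w u i) i))

  incidence-δ : ∀ e f → incidence f (fst e) (snd e) ≈ δ e f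
  incidence-δ e f with f ≟ e
  ... | yes ≡.refl = begin
    δ (fst e) (fst e) * δ (snd e) (snd e) + δ (snd e) (fst e) * δ (fst e) (snd e)
      ≈⟨ +-cong (*-cong (δ-≡ (fst e)) (δ-≡ (snd e))) (δ*-≢ (<ᶠ⇒≢ (fst<snd e))) ⟩
    1# * 1# + 0#  ≈⟨ trans (+-identityʳ _) (*-identityʳ 1#) ⟩
    1#            ≈⟨ δ-≡ e ⟨
    δ e e         ∎
  ... | no f≢e = trans (+-cong first second) (trans (+-identityʳ 0#) (sym (δ-≢ e f f≢e)))
    where
    first : δ (fst f) (fst e) * δ (snd f) (snd e) ≈ 0#
    first with fst e ≟ fst f | snd e ≟ snd f
    ... | no ≢₁ | _ = δ*-≢ ≢₁
    ... | yes _ | no ≢₂ = *δ-≢ ≢₂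
    ... | yes ≡₁ | yes ≡₂ = ⊥-elim (f≢e (ends-injective f e (≡.sym (≡.cong₂ _,_ ≡₁ ≡₂))))
    second : δ (snd f) (fst e) * δ (fst f) (snd e) ≈ 0#
    second with fst e ≟ snd f | snd e ≟ fst f
    ... | no ≢₁ | _ = δ*-≢ ≢₁
    ... | yes _ | no ≢₂ = *δ-≢ ≢₂
    ... | yes ≡₁ | yes ≡₂ = ⊥-elim (<ᶠ-asym (fst<snd f) (≡.subst₂ _<_ ≡₁ ≡₂ (fst<snd e)))

  weight-ends : ∀ a e → weight a (fst e) (snd e) ≈ a e
  weight-ends a e = trans (∑-cong λ f → trans (*-congˡ (incidence-δ e f)) (*-comm _ _)) (sum-δ e a)

  weight-of-symmetric : ∀ (g : Fin n → Fin n → Carrier) → (∀ w u → g w u ≈ g u w) → ∀ w u → w ≢ u →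
    weight (λ e → g (fst e) (snd e)) w u ≈ g w u
  weight-of-symmetric g g-sym w u w≢u with <-cmp w u
  ... | tri≈ _ w≡u _ = ⊥-elim (w≢u w≡u)
  ... | tri< w<u _ _ with edge w<u
  ...   | e , ≡.refl = weight-ends _ e
  weight-of-symmetric g g-sym w u w≢u | tri> _ _ u<w with edge u<w
  ...   | e , ≡.refl = trans (weight-sym _ w u) (trans (weight-ends _ e) (g-sym u w))

  -- The row span of the complete graph on U, with one coefficient for each
  -- ordered pair of vertices instead of each edge.
  Stressed : Subset n → (Fin n → Fin d → Carrier) → Set (c ⊔ ℓ₁)
  Stressed U x = ∃ λ g → (∀ w u → g w u ≈ g u w) × (∀ w u → w ∉ U → g w u ≈ 0#) × (∀ w i → load g w i ≈ x w i)

  Stressed-⊆ : ∀ {U W x} → U ⊆ W → Stressed U x → Stressed W x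
  Stressed-⊆ U⊆W (g , g-sym , g-supp , g-load) = g , g-sym , (λ w u w∉ → g-supp w u (w∉ ∘ U⊆W)) , g-load

  Stressed-off : ∀ {U x} → Stressed U x → ∀ v → v ∉ U → ∀ i → x v i ≈ 0#
  Stressed-off (g , _ , g-supp , g-load) v v∉U i = trans (sym (g-load v i))
    (sum-≈0 {n} _ λ u → trans (*-congʳ (g-supp v u v∉U)) (zeroˡ _))

  weight-off : ∀ {U a} → Supported (complete U) a → ∀ w u → w ∉ U → weight a w u ≈ 0#
  weight-off {U} supp w u w∉U = sum-≈0 {∣K n ∣} _ (supported-*≈0 supp λ e e∈ → incidence-off e w u
    (λ { ≡.refl → w∉U (proj₁ (∈-complete⁻ e∈)) }) (λ { ≡.refl → w∉U (proj₂ (∈-complete⁻ e∈)) }))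

  inSpan⇒Stressed : ∀ {U v} → InSpan rigidityMatrix (complete U) v → Stressed U (λ w i → v (combine w i))
  inSpan⇒Stressed (a , supp , sums) =
    weight a , weight-sym a , weight-off supp , λ w i → trans (sym (combination-load a w i)) (sums (combine w i))

  Stressed⇒inSpan : ∀ {U v} → Stressed U (λ w i → v (combine w i)) → InSpan rigidityMatrix (complete U) v
  Stressed⇒inSpan {U} {v} (g , g-sym , g-supp , g-load) = a , a-supp , a-sums
    where
    a : Fin ∣K n ∣ → Carrier
    a e = g (fst e) (snd e)

    a-supp : Supported (complete U) a
    a-supp e e∉ with fst e ∈? U | snd e ∈? U
    ... | no ∉₁ | _ = g-supp _ _ ∉₁
    ... | yes _ | no ∉₂ = trans (g-sym _ _) (g-supp _ _ ∉₂)
    ... | yes ∈₁ | yes ∈₂ = ⊥-elim (e∉ (∈-complete⁺ ∈₁ ∈₂))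

    -- `g` may have a diagonal, as the star-mesh coefficients do, and `weight a` has none; the
    -- factor `diff w w` removes the difference.
    term : ∀ w i u → weight a w u * diff w u i ≈ g w u * diff w u i
    term w i u with w ≟ u
    ... | yes ≡.refl = trans (*-congˡ (diff-self w i)) (trans (zeroʳ _) (sym (trans (*-congˡ (diff-self w i)) (zeroʳ _))))
    ... | no w≢u = *-congʳ (weight-of-symmetric g g-sym w u w≢u)

    a-sums : ∀ j → combination a rigidityMatrix j ≈ v j
    a-sums j = ≡.subst (λ j → combination a rigidityMatrix j ≈ v j) (combine-remQuot {n} d j)
      (trans (combination-load a w i) (trans (∑-cong (term w i)) (g-load w i)))
      where
      w = proj₁ (remQuot {n} d j)
      i = proj₂ (remQuot {n} d j)

-- Equilibrium stars, the star-mesh transform and modularity of complete graphs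

module GenericRigidity {c ℓ₁ ℓ₂} (K : HeytingField c ℓ₁ ℓ₂) (_#?_ : Decidable (HeytingField._#_ K))
    {n d : ℕ} (p : Fin n → Fin d → HeytingField.Carrier K)
    (general-position : ∀ I → ∣ I ∣ ℕ.≤ suc d →
      LinearAlgebra.RowsIndependent K _#?_ (GenericPosition.homogenise K _#?_ p) I) where
  open HeytingField K hiding (setoid; zero)
  open CommutativeRing (ring K) using (setoid; semiring; *-commutativeSemigroup)
  open LinearAlgebra K _#?_ hiding (x∉p-x)
  open LinearSpan K _#?_
  open LinearRank K _#?_
  open GenericPosition K _#?_ using (homogenise)
  open Rigidity K _#?_ p
  open Edges n
  open CompleteSpans K _#?_ p
  open import Algebra.Properties.CommutativeSemigroup *-commutativeSemigroup using (x∙yz≈y∙xz)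
  open import Algebra.Properties.Semiring.Sum semiring using (sum; ∑-distrib-+; *-distribˡ-sum; *-distribʳ-sum)
  open import Algebra.Properties.Ring (CommutativeRing.ring (ring K)) using (-‿distribˡ-*; -1*x≈-x; -0#≈0#; -‿involutive)
  open import Relation.Binary.Reasoning.Setoid setoid using (begin_; step-≈-⟩; step-≈-⟨; _∎)

  -- α are the stress coefficients of the edges at v, in equilibrium there.
  Equilibrium : (Fin n → Carrier) → Fin n → Set ℓ₁
  Equilibrium α v = ∀ i → sum (λ u → α u * diff v u i) ≈ 0#

  barycentre : ∀ {α v} → Equilibrium α v → ∀ i → sum (λ u → α u * p u i) ≈ sum α * p v i
  barycentre {α} {v} eq i = sym (begin
    sum α * p v i
      ≈⟨ *-distribʳ-sum (p v i) α ⟩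
    sum (λ u → α u * p v i)
      ≈⟨ ∑-cong (λ u → trans (*-congˡ (sym (diff-+-p v u i))) (distribˡ (α u) (diff v u i) (p u i))) ⟩
    sum (λ u → α u * diff v u i + α u * p u i)
      ≈⟨ ∑-distrib-+ (λ u → α u * diff v u i) (λ u → α u * p u i) ⟩
    sum (λ u → α u * diff v u i) + sum (λ u → α u * p u i)
      ≈⟨ trans (+-congʳ (eq i)) (+-identityˡ _) ⟩
    sum (λ u → α u * p u i) ∎)

  sum-*1 : ∀ (α : Fin n → Carrier) → sum (λ u → α u * 1#) ≈ sum α
  sum-*1 α = ∑-cong λ u → *-identityʳ (α u)

  -- With coefficient sum zero the position of `v` drops out, and the equilibrium is an affine
  -- dependence of the points of `I`.
  balanced-equilibrium⇒≈0 : ∀ {I α v} → ∣ I ∣ ℕ.≤ suc d → Supported I α → Equilibrium α v → sum α ≈ 0# →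
    ∀ u → α u ≈ 0#
  balanced-equilibrium⇒≈0 {I} {α} I≤ supp eq s≈0 = general-position I I≤ α supp λ where
    zero    → trans (sum-*1 α) s≈0
    (suc i) → trans (barycentre eq i) (trans (*-congʳ s≈0) (zeroˡ _))

  -- Adding - Σ α at `v` turns the equilibrium into an affine dependence of the points of `I`. The
  -- coefficient at `v` itself stays undetermined, because `diff v v` is zero.
  equilibrium⇒≈0 : ∀ {I α v} → ∣ I ∣ ℕ.≤ suc d → v ∈ I → Supported I α → Equilibrium α v → ∀ u → u ≢ v → α u ≈ 0#
  equilibrium⇒≈0 {I} {α} {v} I≤ v∈I supp eq u u≢v = begin
    α u                         ≈⟨ +-identityʳ _ ⟨
    α u + 0#                    ≈⟨ +-congˡ (*δ-≢ u≢v) ⟨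
    α u + - sum α * δ v u       ≈⟨ general-position I I≤ (λ u → α u + - sum α * δ v u) supp′ sums u ⟩
    0#                          ∎
    where
    supp′ : Supported I (λ u → α u + - sum α * δ v u)
    supp′ w w∉I = trans (+-cong (supp w w∉I) (*δ-≢ {e = v} {w} λ { ≡.refl → w∉I v∈I })) (+-identityʳ 0#)
    cancel : ∀ x → sum α * x + - sum α * x ≈ 0#
    cancel x = trans (+-congˡ (sym (-‿distribˡ-* (sum α) x))) (-‿inverseʳ _)
    sums : ∀ j → combination (λ u → α u + - sum α * δ v u) (homogenise p) j ≈ 0#
    sums zero = trans (sum-shift v (- sum α) α (λ _ → 1#))
      (trans (+-congʳ (trans (sum-*1 α) (sym (*-identityʳ (sum α))))) (cancel 1#))
    sums (suc i) = trans (sum-shift v (- sum α) α (λ u → p u i)) (trans (+-congʳ (barycentre eq i)) (cancel (p v i)))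

  -- If the two points coincided, `δ v` would be an equilibrium at `u` on two vertices; `1 ≤ d`
  -- makes two vertices few enough for general position.
  distinct-points : 1 ℕ.≤ d → ∀ {u v} → u ≢ v → ¬ (∀ i → diff u v i ≈ 0#)
  distinct-points 1≤d {u} {v} u≢v coincide = 1≉0 (trans (sym (δ-≡ v))
    (equilibrium⇒≈0 {⁅ u ⁆ ∪ ⁅ v ⁆} {δ v} {u} size (p⊆p∪q ⁅ v ⁆ (x∈⁅x⁆ u)) (δ-supported (q⊆p∪q ⁅ u ⁆ ⁅ v ⁆ (x∈⁅x⁆ v)))
      (λ i → trans (sum-δ v (λ w → diff u w i)) (coincide i)) v (u≢v ∘ ≡.sym)))
    where
    size : ∣ ⁅ u ⁆ ∪ ⁅ v ⁆ ∣ ℕ.≤ suc d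
    size = ℕ.≤-trans (ℕ.≤-reflexive (≡.trans (x∉p⇒∣p∪⁅x⁆∣ (u≢v ∘ ≡.sym ∘ x∈⁅y⁆⇒x≡y u)) (≡.cong suc (∣⁅x⁆∣≡1 u)))) (s≤s 1≤d)

  -- A star at v in equilibrium can be replaced by a mesh on its other ends.
  Mesh : Subset n → (Fin n → Carrier) → Fin n → Set (c ⊔ ℓ₁)
  Mesh U α v = Stressed U (λ w i → α w * diff w v i)

  -- The star-mesh transform of electrical networks: the coefficient of uw is
  -- α u α w / Σ α.
  star-mesh : ∀ {U α v} → Supported U α → Equilibrium α v → ¬ sum α ≈ 0# → Mesh U α v
  star-mesh {U} {α} {v} supp eq s≉0 = (λ w u → t * α w * α u)
    , (λ w u → trans (*-assoc t _ _) (trans (*-congˡ (*-comm _ _)) (sym (*-assoc t _ _))))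
    , (λ w u w∉ → trans (*-congʳ (trans (*-congˡ (supp w w∉)) (zeroʳ t))) (zeroˡ _))
    , λ w i → begin
      sum (λ u → t * α w * α u * diff w u i)
        -- `diff w u` is routed through `v`: the part from `v` to `u` sums to zero by equilibrium,
        -- and the part from `w` to `v` picks up the factor Σ α.
        ≈⟨ ∑-cong (λ u → trans (*-assoc _ (α u) _) (*-congˡ (trans (*-congˡ (sym (diff-+ w v u i))) (distribˡ (α u) _ _)))) ⟩
      sum (λ u → t * α w * (α u * diff w v i + α u * diff v u i))
        ≈⟨ *-distribˡ-sum (t * α w) (λ u → α u * diff w v i + α u * diff v u i) ⟨
      t * α w * sum (λ u → α u * diff w v i + α u * diff v u i)
        ≈⟨ *-congˡ (∑-distrib-+ (λ u → α u * diff w v i) (λ u → α u * diff v u i)) ⟩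
      t * α w * (sum (λ u → α u * diff w v i) + sum (λ u → α u * diff v u i))
        ≈⟨ *-congˡ (trans (+-cong (sym (*-distribʳ-sum (diff w v i) α)) (eq i)) (+-identityʳ _)) ⟩
      t * α w * (sum α * diff w v i)
        ≈⟨ *-congʳ (*-comm t (α w)) ⟩
      α w * t * (sum α * diff w v i)
        ≈⟨ trans (*-assoc (α w) t _) (*-congˡ (sym (*-assoc t (sum α) _))) ⟩
      α w * (t * sum α * diff w v i)
        ≈⟨ *-congˡ (trans (*-congʳ ts≈1) (*-identityˡ _)) ⟩
      α w * diff w v i ∎
    where
    t = proj₁ (inverse s≉0)
    ts≈1 = proj₂ (inverse s≉0)

  Stressed-+ : ∀ {U x y z} → Stressed U x → Stressed U y → (∀ w i → x w i + y w i ≈ z w i) → Stressed U z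
  Stressed-+ (g , g-sym , g-supp , g-load) (h , h-sym , h-supp , h-load) eq =
    (λ w u → g w u + h w u)
    , (λ w u → +-cong (g-sym w u) (h-sym w u))
    , (λ w u w∉ → trans (+-cong (g-supp w u w∉) (h-supp w u w∉)) (+-identityʳ 0#))
    , λ w i → trans (load-+ g h w i) (trans (+-cong (g-load w i) (h-load w i)) (eq w i))

  Stressed-0 : ∀ {U x} → (∀ w i → x w i ≈ 0#) → Stressed U x
  Stressed-0 x≈0 = (λ _ _ → 0#) , (λ _ _ → refl) , (λ _ _ _ → refl) ,
    λ w i → trans (sum-≈0 {n} _ λ u → zeroˡ _) (sym (x≈0 w i))

  -- Any d + 1 difference vectors in d coordinates are dependent, and a dependency with coefficient
  -- sum zero would contradict general position.
  unbalanced-equilibrium : ∀ {U} v → suc d ℕ.≤ ∣ U ∣ →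
    ∃ λ α → Supported U α × Equilibrium α v × ¬ sum α ≈ 0#
  unbalanced-equilibrium {U} v d<U with subset-of-size (suc d) U d<U
  ... | I , I⊆U , ∣I∣≡ with independent-or-dependent (λ u i → diff v u i) I
  ...   | inj₁ ind = ⊥-elim (ℕ.<-irrefl ≡.refl (ℕ.≤-trans
            (≡.subst₂ ℕ._≤_ ∣I∣≡ ≡.refl (independent-size (λ u i → diff v u i) I full (λ _ _ _ ∉ → ⊥-elim (∉ ∈⊤)) ind))
            (∣p∣≤n full)))
  ...   | inj₂ (α , supp , eq , u , αu≉0) = α , Supported-⊆ I⊆U supp , eq ,
            λ s≈0 → αu≉0 (balanced-equilibrium⇒≈0 (ℕ.≤-reflexive ∣I∣≡) supp eq s≈0 u)

  -- `star-mesh` divides by Σ α. If this is zero, α is an affine dependence: it vanishes when `U`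
  -- has at most d + 1 vertices, and a larger `U` carries an equilibrium of nonzero sum to shift it
  -- by.
  mesh : ∀ {U α v} → Supported U α → Equilibrium α v → Mesh U α v
  mesh {U} {α} {v} supp eq with sum α ≈0?
  ... | no s≉0 = star-mesh supp eq s≉0
  ... | yes s≈0 with ∣ U ∣ ℕ.≤? suc d
  ...   | yes U≤ = Stressed-0 λ w i → trans (*-congʳ (balanced-equilibrium⇒≈0 U≤ supp eq s≈0 w)) (zeroˡ _)
  ...   | no U≰ with unbalanced-equilibrium {U} v (ℕ.≤-trans (ℕ.n≤1+n _) (ℕ.≰⇒> U≰))
  ...     | γ , γ-supp , γ-eq , r≉0 = Stressed-+ (star-mesh supp₁ eq₁ s₁≉0) (star-mesh supp₂ eq₂ s₂≉0) split
    where
    -- α = (α + γ) + (- γ), and neither summand has coefficient sum zero.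
    supp₁ : Supported U (λ u → α u + γ u)
    supp₁ u u∉ = trans (+-cong (supp u u∉) (γ-supp u u∉)) (+-identityʳ 0#)
    supp₂ : Supported U (λ u → - 1# * γ u)
    supp₂ u u∉ = trans (*-congˡ (γ-supp u u∉)) (zeroʳ _)
    eq₁ : Equilibrium (λ u → α u + γ u) v
    eq₁ i = trans (combination-+ α γ (λ u i → diff v u i) i) (trans (+-cong (eq i) (γ-eq i)) (+-identityʳ 0#))
    eq₂ : Equilibrium (λ u → - 1# * γ u) v
    eq₂ i = trans (combination-* (- 1#) γ (λ u i → diff v u i) i) (trans (*-congˡ (γ-eq i)) (zeroʳ _))
    s₁≉0 : ¬ sum (λ u → α u + γ u) ≈ 0#
    s₁≉0 s₁≈0 = r≉0 (trans (sym (+-identityˡ _)) (trans (+-congʳ (sym s≈0)) (trans (sym (∑-distrib-+ α γ)) s₁≈0)))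
    s₂≉0 : ¬ sum (λ u → - 1# * γ u) ≈ 0#
    s₂≉0 s₂≈0 = r≉0 (x*y≈0⇒y≈0 -1≉0 (trans (*-distribˡ-sum (- 1#) γ) s₂≈0))
      where
      -1≉0 : ¬ - 1# ≈ 0#
      -1≉0 -1≈0 = 1≉0 (trans (sym (-‿involutive 1#)) (trans (-‿cong -1≈0) -0#≈0#))
    split : ∀ w i → (α w + γ w) * diff w v i + - 1# * γ w * diff w v i ≈ α w * diff w v i
    split w i = begin
      (α w + γ w) * diff w v i + - 1# * γ w * diff w v i  ≈⟨ distribʳ _ _ _ ⟨
      (α w + γ w + - 1# * γ w) * diff w v i               ≈⟨ *-congʳ (+-assoc _ _ _) ⟩
      (α w + (γ w + - 1# * γ w)) * diff w v i             ≈⟨ *-congʳ (+-congˡ (+-congˡ (-1*x≈-x (γ w)))) ⟩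
      (α w + (γ w - γ w)) * diff w v i                    ≈⟨ *-congʳ (trans (+-congˡ (-‿inverseʳ _)) (+-identityʳ _)) ⟩
      α w * diff w v i                                    ∎

  avoid : Fin n → Fin n → Carrier
  avoid v u with u ≟ v
  ... | yes _ = 0#
  ... | no  _ = 1#

  sum-avoid : ∀ v (t : Fin n → Carrier) → sum (λ u → avoid v u * t u) + t v ≈ sum t
  sum-avoid v t = trans (+-congˡ (sym (sum-δ v t))) (trans
    (sym (∑-distrib-+ (λ u → avoid v u * t u) (λ u → δ v u * t u))) (∑-cong term))
    where
    term : ∀ u → avoid v u * t u + δ v u * t u ≈ t u
    term u with u ≟ v
    ... | yes ≡.refl = trans (+-cong (zeroˡ _) (trans (*-congʳ (δ-≡ u)) (*-identityˡ _))) (+-identityˡ _)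
    ... | no u≢v = trans (+-cong (*-identityˡ _) (δ*-≢ u≢v)) (+-identityʳ _)

  remove-vertex : ∀ {U x} v → Stressed U x → (∀ i → x v i ≈ 0#) → Stressed (U ∖ v) x
  remove-vertex {U} {x} v (g , g-sym , g-supp , g-load) xv≈0 = Stressed-+ rest (mesh α-supp α-eq) total
    where
    α : Fin n → Carrier
    -- The diagonal entry at `v` is dropped: equilibrium does not see it, and the mesh must avoid
    -- `v`.
    α u = avoid v u * g u v

    α-supp : Supported (U ∖ v) α
    α-supp u u∉ with u ≟ v
    ... | yes ≡.refl = zeroˡ _
    ... | no u≢v = trans (*-congˡ (g-supp u v λ u∈U → u∉ (x∈p∧x≢y⇒x∈p-y u∈U u≢v))) (zeroʳ _)

    α-eq : Equilibrium α v
    α-eq i = begin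
      sum (λ u → avoid v u * g u v * diff v u i)
        ≈⟨ ∑-cong (λ u → trans (*-assoc _ _ _) (*-congˡ (*-congʳ (g-sym u v)))) ⟩
      sum (λ u → avoid v u * (g v u * diff v u i))
        ≈⟨ trans (sym (+-identityʳ _)) (+-congˡ (sym (trans (*-congˡ (diff-self v i)) (zeroʳ _)))) ⟩
      sum (λ u → avoid v u * (g v u * diff v u i)) + g v v * diff v v i
        ≈⟨ sum-avoid v (λ u → g v u * diff v u i) ⟩
      load g v i
        ≈⟨ trans (g-load v i) (xv≈0 i) ⟩
      0# ∎

    h : Fin n → Fin n → Carrier
    h w u = avoid v w * (avoid v u * g w u)

    h-supp : ∀ w u → w ∉ U ∖ v → h w u ≈ 0#
    h-supp w u w∉ with w ≟ v
    ... | yes ≡.refl = zeroˡ _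
    ... | no w≢v = trans (*-congˡ (trans (*-congˡ (g-supp w u λ w∈U → w∉ (x∈p∧x≢y⇒x∈p-y w∈U w≢v))) (zeroʳ _))) (zeroʳ _)

    rest : Stressed (U ∖ v) (load h)
    rest = h , (λ w u → trans (*-congˡ (*-congˡ (g-sym w u))) (x∙yz≈y∙xz _ _ _)) , h-supp , λ _ _ → refl

    load-h : ∀ w i → load h w i ≈ avoid v w * sum (λ u → avoid v u * (g w u * diff w u i))
    load-h w i = trans (∑-cong λ u → trans (*-assoc (avoid v w) (avoid v u * g w u) _) (*-congˡ (*-assoc (avoid v u) (g w u) _)))
      (sym (*-distribˡ-sum (avoid v w) (λ u → avoid v u * (g w u * diff w u i))))

    total : ∀ w i → load h w i + α w * diff w v i ≈ x w i
    total w i = trans (+-cong (load-h w i) (*-assoc _ _ _)) (trans (sym (distribˡ _ _ _))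
      (trans (*-congˡ (trans (sum-avoid v (λ u → g w u * diff w u i)) (g-load w i))) (at w)))
      where
      at : ∀ w → avoid v w * x w i ≈ x w i
      at w with w ≟ v
      ... | yes ≡.refl = trans (zeroˡ _) (sym (xv≈0 i))
      ... | no _ = *-identityˡ _

  restrict : ∀ t {U x} W → ∣ U ∣ ℕ.≤ t → Stressed U x → (∀ v → v ∉ W → ∀ i → x v i ≈ 0#) → Stressed (U ∩ W) x
  restrict t {U} W U≤t s off with any? (λ v → (v ∈? U) ×-dec ¬? (v ∈? W))
  ... | no none = Stressed-⊆ (λ u∈U → x∈p∩q⁺ (u∈U , inW u∈U)) s
    where
    inW : ∀ {u} → u ∈ U → u ∈ W
    inW {u} u∈U with u ∈? W
    ... | yes u∈W = u∈W
    ... | no u∉W = ⊥-elim (none (u , u∈U , u∉W))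
  restrict zero {U} W U≤t s off | yes (v , v∈U , _) = ⊥-elim (ℕ.<⇒≱ (x∈p⇒∣p-x∣<∣p∣ v∈U) (ℕ.≤-trans U≤t z≤n))
  restrict (suc t) {U} W U≤t s off | yes (v , v∈U , v∉W) = Stressed-⊆
    (λ u∈ → let u∈U-v , u∈W = x∈p∩q⁻ (U ∖ v) W u∈ in x∈p∩q⁺ (p─q⊆p U ⁅ v ⁆ u∈U-v , u∈W))
    (restrict t W (ℕ.≤-pred (ℕ.≤-trans (x∈p⇒∣p-x∣<∣p∣ v∈U) U≤t)) (remove-vertex v s (off v v∉W)) off)

  -- A vector in the second span vanishes at every vertex outside `W`, which is what `restrict`
  -- needs in order to remove these vertices from `U`.
  complete-modular : ∀ U W →
    rank (complete U ∩ complete W) ℕ.+ rank (complete U ∪ complete W) ≡ rank (complete U) ℕ.+ rank (complete W)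
  complete-modular U W = rank-modular rigidityMatrix λ v inU inW →
    ≡.subst (λ X → InSpan rigidityMatrix X v) (≡.sym (complete-∩ U W))
      (Stressed⇒inSpan (restrict ∣ U ∣ W ℕ.≤-refl (inSpan⇒Stressed inU) (Stressed-off (inSpan⇒Stressed inW))))

-- Numerical rank bounds for complete graphs

C2-suc : ∀ t → suc t C 2 ≡ t ℕ.+ t C 2
C2-suc t = ≡.trans (≡.sym (nCk+nC[k+1]≡[n+1]C[k+1] t 1)) (≡.cong (ℕ._+ t C 2) (nC1≡n t))

-- The two regimes of the rank bound meet at t = d, where C(d,2) has to equal d * d - C(d+1,2).
C2-+-C2 : ∀ t → t C 2 ℕ.+ suc t C 2 ≡ t ℕ.* t
C2-+-C2 zero = ≡.refl
C2-+-C2 (suc t) = ≡.trans (≡.cong₂ ℕ._+_ (C2-suc t) (C2-suc (suc t)))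
  (≡.trans (solve 3 (λ t c c′ → (t :+ c) :+ (con 1 :+ t :+ c′) := (c :+ c′) :+ (t :+ (con 1 :+ t))) ≡.refl t (t C 2) (suc t C 2))
    (≡.trans (≡.cong (ℕ._+ (t ℕ.+ suc t)) (C2-+-C2 t))
      (solve 1 (λ t → t :* t :+ (t :+ (con 1 :+ t)) := (con 1 :+ t) :* (con 1 :+ t)) ≡.refl t)))

module RankBound (d : ℕ) where

  -- A new vertex raises the rank of a complete graph on t vertices by at most
  -- t ⊓ d.
  rank-bound : ℕ → ℕ
  rank-bound zero    = 0
  rank-bound (suc t) = rank-bound t ℕ.+ (t ℕ.⊓ d)

  rank-bound-small : ∀ t → t ℕ.≤ d → rank-bound t ≡ t C 2
  rank-bound-small zero    _   = ≡.refl
  rank-bound-small (suc t) t<d = ≡.trans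
    (≡.cong₂ ℕ._+_ (rank-bound-small t (ℕ.<⇒≤ t<d)) (ℕ.m≤n⇒m⊓n≡m (ℕ.<⇒≤ t<d)))
    (≡.trans (ℕ.+-comm (t C 2) t) (≡.sym (C2-suc t)))

  rank-bound-large : ∀ s → rank-bound (s ℕ.+ d) ℕ.+ suc d C 2 ≡ d ℕ.* (s ℕ.+ d)
  rank-bound-large zero    = ≡.trans (≡.cong (ℕ._+ suc d C 2) (rank-bound-small d ℕ.≤-refl)) (C2-+-C2 d)
  rank-bound-large (suc s) = begin
    rank-bound (s ℕ.+ d) ℕ.+ ((s ℕ.+ d) ℕ.⊓ d) ℕ.+ suc d C 2
      ≡⟨ ≡.cong (λ x → rank-bound (s ℕ.+ d) ℕ.+ x ℕ.+ suc d C 2) (ℕ.m≥n⇒m⊓n≡n (ℕ.m≤n+m d s)) ⟩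
    rank-bound (s ℕ.+ d) ℕ.+ d ℕ.+ suc d C 2
      ≡⟨ solve 3 (λ b d c → b :+ d :+ c := d :+ (b :+ c)) ≡.refl (rank-bound (s ℕ.+ d)) d (suc d C 2) ⟩
    d ℕ.+ (rank-bound (s ℕ.+ d) ℕ.+ suc d C 2)
      ≡⟨ ≡.cong (d ℕ.+_) (rank-bound-large s) ⟩
    d ℕ.+ d ℕ.* (s ℕ.+ d)
      ≡⟨ ℕ.*-suc d (s ℕ.+ d) ⟨
    d ℕ.* suc (s ℕ.+ d) ∎
    where open ≡.≡-Reasoning

-- Closures of rigid cyclic sets and the rank of their intersection

module Balance {c ℓ₁ ℓ₂} (K : HeytingField c ℓ₁ ℓ₂) (_#?_ : Decidable (HeytingField._#_ K))
    {n d : ℕ} (p : Fin n → Fin d → HeytingField.Carrier K)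
    (general-position : ∀ I → ∣ I ∣ ℕ.≤ suc d →
      LinearAlgebra.RowsIndependent K _#?_ (GenericPosition.homogenise K _#?_ p) I) where
  open HeytingField K hiding (setoid; zero)
  open LinearAlgebra K _#?_ hiding (x∉p-x)
  open LinearSpan K _#?_
  open LinearRank K _#?_
  open Rigidity K _#?_ p
  open Edges n
  open CompleteSpans K _#?_ p
  open GenericRigidity K _#?_ p general-position
  open RankBound d
  open ≡.≡-Reasoning

  row-self : ∀ e i → rigidityMatrix e (combine (fst e) i) ≈ diff (fst e) (snd e) i
  row-self e i = trans (row-incidence e (fst e) i) (trans (sum-incidence e (fst e) (λ u → diff (fst e) u i))
    (trans (+-cong (trans (*-congʳ (δ-≡ (fst e))) (*-identityˡ _)) (δ*-≢ (<ᶠ⇒≢ (fst<snd e)))) (+-identityʳ _)))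

  row-other : ∀ e i → rigidityMatrix e (combine (snd e) i) ≈ diff (snd e) (fst e) i
  row-other e i = trans (row-incidence e (snd e) i) (trans (sum-incidence e (snd e) (λ u → diff (snd e) u i))
    (trans (+-cong (δ*-≢ (<ᶠ⇒≢ (fst<snd e) ∘ ≡.sym)) (trans (*-congʳ (δ-≡ (snd e))) (*-identityˡ _))) (+-identityˡ _)))

  -- The row of `e` is nonzero in the columns of both of its ends, while the span of `complete U`
  -- vanishes at every vertex outside `U`.
  inSpan-complete⇒∈ : 1 ℕ.≤ d → ∀ {U e} → InSpan rigidityMatrix (complete U) (rigidityMatrix e) → e ∈ complete U
  inSpan-complete⇒∈ 1≤d {U} {e} span with fst e ∈? U | snd e ∈? U
  ... | yes ∈₁ | yes ∈₂ = ∈-complete⁺ ∈₁ ∈₂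
  ... | no ∉₁ | _ = ⊥-elim (distinct-points 1≤d (<ᶠ⇒≢ (fst<snd e)) λ i →
    trans (sym (row-self e i)) (Stressed-off (inSpan⇒Stressed span) (fst e) ∉₁ i))
  ... | yes _ | no ∉₂ = ⊥-elim (distinct-points 1≤d (<ᶠ⇒≢ (fst<snd e) ∘ ≡.sym) λ i →
    trans (sym (row-other e i)) (Stressed-off (inSpan⇒Stressed span) (snd e) ∉₂ i))

  -- A vanishing combination puts every star in equilibrium, and general position leaves no nonzero
  -- star on so few vertices.
  small-complete-independent : ∀ {U} → ∣ U ∣ ℕ.≤ suc d → RowsIndependent rigidityMatrix (complete U)
  small-complete-independent {U} U≤ a supp sums e with e ∈? complete U
  ... | no e∉ = supp e e∉
  ... | yes e∈ = trans (sym (weight-ends a e))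
    (equilibrium⇒≈0 U≤ (proj₁ (∈-complete⁻ e∈))
      (λ u u∉U → trans (weight-sym a (fst e) u) (weight-off supp u (fst e) u∉U))
      (λ i → trans (sym (combination-load a (fst e) i)) (sums (combine (fst e) i)))
      (snd e) (<ᶠ⇒≢ (fst<snd e) ∘ ≡.sym))

  -- Let `Q` extend a basis `B` of `complete (U ∖ v)` to one of `complete U`. A combination of `Q`
  -- that vanishes in the columns of `v` lies in the span of `B` by `remove-vertex`, hence is
  -- trivial. So the rows of `Q` remain independent when cut down to the `d` columns of `v`.
  rank-complete-step : ∀ {U v} → v ∈ U →
    rank (complete U) ℕ.≤ rank (complete (U ∖ v)) ℕ.+ (∣ U ∖ v ∣ ℕ.⊓ d)
  rank-complete-step {U} {v} v∈U with basis rigidityMatrix (complete (U ∖ v))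
  ... | B , B⊆ , B-ind , B-spans with extend rigidityMatrix (complete-⊆ (p─q⊆p U ⁅ v ⁆) ∘ B⊆) B-ind
  ...   | B′ , B⊆B′ , B′⊆ , B′-ind , B′-spans = ℕ.≤-trans (ℕ.≤-reflexive (≡.sym (basis-size rigidityMatrix (B′⊆ , B′-ind , B′-spans))))
    (ℕ.≤-trans (p⊆q⇒∣p∣≤∣q∣ B′⊆B∪Q) (ℕ.≤-trans (ℕ.≤-reflexive (∣p∪q∣≡∣p∣+∣q∣ B Q disjoint))
      (ℕ.+-mono-≤ (ℕ.≤-reflexive (basis-size rigidityMatrix (B⊆ , B-ind , B-spans))) (ℕ.⊓-glb Q≤U-v Q≤d))))
    where
    Q : EdgeSet n
    Q = B′ ─ B

    Q⊆B′ : Q ⊆ B′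
    Q⊆B′ = p─q⊆p B′ B

    B′⊆B∪Q : B′ ⊆ B ∪ Q
    B′⊆B∪Q {e} e∈B′ with e ∈? B
    ... | yes e∈B = p⊆p∪q Q e∈B
    ... | no  e∉B = q⊆p∪q B Q (x∈p∧x∉q⇒x∈p─q e∈B′ e∉B)

    disjoint : Empty (B ∩ Q)
    disjoint (e , e∈) = let e∈B , e∈Q = x∈p∩q⁻ B Q e∈ in x∈p─q⇒x∉q B′ B e∈Q e∈B

    independent-at-v : ∀ a → Supported Q a → (∀ i → combination a rigidityMatrix (combine v i) ≈ 0#) → ∀ e → a e ≈ 0#
    independent-at-v a supp sums e with e ∈? Q
    ... | no e∉Q = supp e e∉Q
    ... | yes e∈Q with InSpan-trans rigidityMatrix B-spans (Stressed⇒inSpan (remove-vertex v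
                        (inSpan⇒Stressed {U} (a , Supported-⊆ (B′⊆ ∘ Q⊆B′) supp , λ _ → refl)) sums))
    ...   | b , b-supp , b-sums = trans
      (coefficients-unique rigidityMatrix B′-ind (Supported-⊆ Q⊆B′ supp) (Supported-⊆ B⊆B′ b-supp) (λ j → sym (b-sums j)) e)
      (b-supp e (x∈p─q⇒x∉q B′ B e∈Q))

    Q≤d : ∣ Q ∣ ℕ.≤ d
    Q≤d = ℕ.≤-trans (independent-size (λ e i → rigidityMatrix e (combine v i)) Q full
      (λ _ _ _ ∉ → ⊥-elim (∉ ∈⊤)) independent-at-v) (∣p∣≤n full)

    Q≤U-v : ∣ Q ∣ ℕ.≤ ∣ U ∖ v ∣
    -- The columns of `v` are combinations of the incidences at `v`, so these are independent too;
    -- they are indexed by the other vertices.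
    Q≤U-v = independent-size (λ e u → incidence e v u) Q (U ∖ v) incidence-supp λ a supp sums →
      independent-at-v a supp λ i → trans (combination-load a v i)
        (sum-≈0 {n} _ λ u → trans (*-congʳ (sums u)) (zeroˡ _))
      where
      incidence-supp : ∀ e → e ∈ Q → Supported (U ∖ v) (incidence e v)
      incidence-supp e e∈Q u u∉ with ∈-complete⁻ (B′⊆ (Q⊆B′ e∈Q)) | u ≟ v
      ... | e₁∈ , e₂∈ | no u≢v = trans (incidence-sym e v u) (incidence-off e u v
        (λ { ≡.refl → u∉ (x∈p∧x≢y⇒x∈p-y e₁∈ u≢v) }) (λ { ≡.refl → u∉ (x∈p∧x≢y⇒x∈p-y e₂∈ u≢v) }))
      ... | _ | yes ≡.refl = trans (+-cong (trans product (δδ≈0)) δδ≈0) (+-identityʳ 0#)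
        where
        product : δ (fst e) u * δ (snd e) u ≈ δ (snd e) u * δ (fst e) u
        product = *-comm _ _
        δδ≈0 : δ (snd e) u * δ (fst e) u ≈ 0#
        δδ≈0 with u ≟ fst e
        ... | no u≢ = *δ-≢ u≢
        ... | yes ≡.refl = δ*-≢ (<ᶠ⇒≢ (fst<snd e))

  rank-complete≤ : ∀ t U → ∣ U ∣ ≡ t → rank (complete U) ℕ.≤ rank-bound t
  rank-complete≤ zero U U≡0 = ℕ.≤-trans (rank≤∣∣ rigidityMatrix (complete U))
    (ℕ.≤-reflexive (≡.trans (≡.cong ∣_∣ (Empty-unique {p = complete U} empty)) (∣⊥∣≡0 ∣K n ∣)))
    where
    empty : Empty (complete U)
    empty (e , e∈) = ℕ.<⇒≱ (x∈p⇒∣p-x∣<∣p∣ (proj₁ (∈-complete⁻ {U} e∈))) (ℕ.≤-trans (ℕ.≤-reflexive U≡0) z≤n)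
  rank-complete≤ (suc t) U U≡ with nonempty? U
  ... | no empty = ⊥-elim (ℕ.0≢1+n (≡.trans (≡.sym (∣⊥∣≡0 n)) (≡.trans (≡.cong ∣_∣ (≡.sym (Empty-unique empty))) U≡)))
  ... | yes (v , v∈U) = ℕ.≤-trans (rank-complete-step v∈U)
    (ℕ.≤-trans (ℕ.+-monoˡ-≤ _ (rank-complete≤ t (U ∖ v) size)) (ℕ.≤-reflexive (≡.cong (λ s → rank-bound t ℕ.+ (s ℕ.⊓ d)) size)))
    where
    size : ∣ U ∖ v ∣ ≡ t
    size = ℕ.≤-antisym (ℕ.≤-pred (≡.subst (suc ∣ U ∖ v ∣ ℕ.≤_) U≡ (x∈p⇒∣p-x∣<∣p∣ v∈U)))
                       (ℕ.≤-pred (≡.subst (ℕ._≤ suc ∣ U ∖ v ∣) U≡ (∣p∣≤1+∣p-x∣ U v)))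

  rank-complete-large : ∀ U → d ℕ.≤ ∣ U ∣ → rank (complete U) ℕ.+ suc d C 2 ℕ.≤ d ℕ.* ∣ U ∣
  rank-complete-large U d≤U = ℕ.≤-trans (ℕ.+-monoˡ-≤ (suc d C 2) (rank-complete≤ ∣ U ∣ U ≡.refl))
    (ℕ.≤-reflexive (≡.subst (λ t → rank-bound t ℕ.+ suc d C 2 ≡ d ℕ.* t) (ℕ.m∸n+n≡m d≤U) (rank-bound-large (∣ U ∣ ℕ.∸ d))))

  ⊆-complete-spanned : ∀ F → F ⊆ complete (spanned F)
  ⊆-complete-spanned F {e} e∈F = ∈-complete⁺ (∈-spanned (inj₁ ≡.refl)) (∈-spanned (inj₂ ≡.refl))
    where
    ∈-spanned : ∀ {w} → (w ≡ fst e) ⊎ (w ≡ snd e) → w ∈ spanned F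
    ∈-spanned w≡ = ∈-tabulate⁺ (λ w → any? λ e → (e ∈? F) ×-dec ((w ≟ fst e) ⊎-dec (w ≟ snd e))) (e , e∈F , w≡)

  complete-spanned-nonempty : ∀ F → Nonempty (complete (spanned F)) → Nonempty F
  complete-spanned-nonempty F (e , e∈) with ∈-tabulate⁻
    (λ w → any? λ e → (e ∈? F) ×-dec ((w ≟ fst e) ⊎-dec (w ≟ snd e))) (proj₁ (∈-complete⁻ {spanned F} e∈))
  ... | f , f∈F , _ = f , f∈F

  cyclic-dependent : ∀ {F} → IsCyclic F → Nonempty F → ¬ RowsIndependent rigidityMatrix F
  cyclic-dependent ([] , [] , ≡.refl) (e , e∈F) ind = ∉⊥ e∈F
  cyclic-dependent (_ ∷ Cs , (dependent , _) ∷ _ , ≡.refl) _ ind = dependent (independent-⊆ rigidityMatrix (p⊆p∪q (⋃ Cs)) ind)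

  rigid-spans : ∀ {W F} → F ⊆ complete W → (Nonempty (complete W) → Nonempty F) → IsCyclic F → IsRigidGraph W F →
    Spans rigidityMatrix F (complete W)
  rigid-spans {W} F⊆ nonempty cyclic (inj₁ (complete-F , _)) e e∈ = let ∈₁ , ∈₂ = ∈-complete⁻ {W} e∈ in
    row-inSpan rigidityMatrix (complete-F e ∈₁ ∈₂)
  rigid-spans {W} F⊆ nonempty cyclic (inj₂ rank-F) with ∣ W ∣ ℕ.≤? suc d
  -- Below d vertices the count is less than C(|W|,2) and would not make `F` spanning. But here
  -- `complete W` is independent and a nonempty cyclic `F` is not, so there is no edge to span.
  ... | yes small = λ e e∈ → ⊥-elim (cyclic-dependent cyclic (nonempty (e , e∈))
            (independent-⊆ rigidityMatrix F⊆ (small-complete-independent small)))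
  ... | no large = rank≤⇒spanning rigidityMatrix F⊆
            (ℕ.+-cancelʳ-≤ (suc d C 2) _ _ (ℕ.≤-trans
              (rank-complete-large W (ℕ.≤-trans (ℕ.n≤1+n d) (ℕ.≤-trans (ℕ.n≤1+n _) (ℕ.≰⇒> large))))
              (ℕ.≤-reflexive (≡.sym rank-F))))

  cl-rigid : 1 ℕ.≤ d → ∀ {F W} → F ⊆ complete W → (Nonempty (complete W) → Nonempty F) → IsCyclic F → IsRigidGraph W F →
    cl F ≡ complete W
  cl-rigid 1≤d F⊆ nonempty cyclic rigid = ⊆-antisym
    (λ e∈ → inSpan-complete⇒∈ 1≤d (InSpan-⊆ rigidityMatrix F⊆ (∈cl⇒inSpan rigidityMatrix e∈)))
    (λ e∈ → inSpan⇒∈cl rigidityMatrix (rigid-spans F⊆ nonempty cyclic rigid _ e∈))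

  ⊆cl : ∀ {X : EdgeSet n} → X ⊆ cl X
  ⊆cl x∈ = inSpan⇒∈cl rigidityMatrix (row-inSpan rigidityMatrix x∈)

  rank-cl : ∀ X → rank (cl X) ≡ rank X
  rank-cl X = ≡.sym (spanning⇒rank≡ rigidityMatrix ⊆cl λ _ → ∈cl⇒inSpan rigidityMatrix)

  modular-step : ∀ {D A₀ : EdgeSet n} W₀ W → cl (D ─ A₀) ≡ complete W₀ → A₀ ⊆ complete W →
    Spans rigidityMatrix D (complete W) → rank (D ─ A₀) ℕ.+ ∣ A₀ ∣ ≡ suc (rank D) →
    rank (complete (W₀ ∩ W)) ℕ.+ ∣ A₀ ∣ ≡ suc (rank (complete W))
  modular-step {D} {A₀} W₀ W cl≡ A₀⊆ spans rank-A₀ =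
    cancel (rank (complete (W₀ ∩ W))) (rank D) (rank (complete W₀)) (rank (complete W)) (∣ A₀ ∣)
      modular (≡.trans (≡.cong (ℕ._+ ∣ A₀ ∣) rank-W₀) rank-A₀)
    where
    cancel : ∀ m r r₀ r₁ a → m ℕ.+ r ≡ r₀ ℕ.+ r₁ → r₀ ℕ.+ a ≡ suc r → m ℕ.+ a ≡ suc r₁
    cancel m r r₀ r₁ a mod r₀+a = ℕ.+-cancelʳ-≡ r _ _ (begin
      m ℕ.+ a ℕ.+ r     ≡⟨ solve 3 (λ m a r → m :+ a :+ r := m :+ r :+ a) ≡.refl m a r ⟩
      m ℕ.+ r ℕ.+ a     ≡⟨ ≡.cong (ℕ._+ a) mod ⟩
      r₀ ℕ.+ r₁ ℕ.+ a   ≡⟨ solve 3 (λ r₀ r₁ a → r₀ :+ r₁ :+ a := r₁ :+ (r₀ :+ a)) ≡.refl r₀ r₁ a ⟩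
      r₁ ℕ.+ (r₀ ℕ.+ a) ≡⟨ ≡.cong (r₁ ℕ.+_) r₀+a ⟩
      r₁ ℕ.+ suc r      ≡⟨ ℕ.+-suc r₁ r ⟩
      suc r₁ ℕ.+ r      ∎)

    rank-W₀ : rank (complete W₀) ≡ rank (D ─ A₀)
    rank-W₀ = ≡.trans (≡.cong rank (≡.sym cl≡)) (rank-cl (D ─ A₀))

    D⊆ : D ⊆ complete W₀ ∪ complete W
    D⊆ {e} e∈D with e ∈? A₀
    ... | no e∉₀ = p⊆p∪q (complete W) (≡.subst (e ∈_) cl≡ (⊆cl (x∈p∧x∉q⇒x∈p─q e∈D e∉₀)))
    ... | yes e∈₀ = q⊆p∪q (complete W₀) (complete W) (A₀⊆ e∈₀)

    rank-D : rank D ≡ rank (complete W₀ ∪ complete W)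
    rank-D = spanning⇒rank≡ rigidityMatrix D⊆ (Spans-∪ rigidityMatrix
      (≡.subst (Spans rigidityMatrix D) cl≡ λ e e∈ → InSpan-⊆ rigidityMatrix (p─q⊆p D A₀) (∈cl⇒inSpan rigidityMatrix e∈))
      spans)

    modular : rank (complete (W₀ ∩ W)) ℕ.+ rank D ≡ rank (complete W₀) ℕ.+ rank (complete W)
    modular = ≡.trans (≡.cong₂ ℕ._+_ (≡.cong rank (≡.sym (complete-∩ W₀ W))) rank-D) (complete-modular W₀ W)

  ⋂-cl-spanned : ∀ {ℓ D} (A : Fin (suc ℓ) → EdgeSet n) → Spans rigidityMatrix D (⋂ (List.tabulate λ i → cl (D ─ A i)))
  ⋂-cl-spanned {D = D} A e e∈ = InSpan-⊆ rigidityMatrix (p─q⊆p D (A zero))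
    (∈cl⇒inSpan rigidityMatrix (p∩q⊆p (cl (D ─ A zero)) (⋂ (List.tabulate λ i → cl (D ─ A (suc i)))) e∈))

  -- The equation says, without subtraction, that the rank drops by |A i| - 1 for every part. The
  -- vertex set `W` belongs to the claim because the next step applies modularity to `complete W`.
  -- There is at least one part: the empty intersection is the whole edge set, which `D` need not
  -- span.
  PartsRank : ∀ {ℓ} → EdgeSet n → (Fin (suc ℓ) → EdgeSet n) → Set
  PartsRank {ℓ} D A = ∃ λ W → ⋂ (List.tabulate λ i → cl (D ─ A i)) ≡ complete W ×
                              rank (complete W) ℕ.+ ∣ ⋃ (List.tabulate A) ∣ ≡ rank D ℕ.+ suc ℓ

  parts-rank : ∀ {ℓ} D (A : Fin (suc ℓ) → EdgeSet n) → (∀ i j → i ≢ j → Empty (A i ∩ A j)) → (∀ i → A i ⊆ D) →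
    (∀ i → ∃ λ W → cl (D ─ A i) ≡ complete W) → (∀ i → rank (D ─ A i) ℕ.+ ∣ A i ∣ ≡ suc (rank D)) → PartsRank D A
  parts-rank {zero} D A disjoint A⊆D closures ranks = proj₁ (closures zero)
    , ≡.trans (∩-identityʳ (cl (D ─ A zero))) (proj₂ (closures zero)) , (begin
    rank (complete (proj₁ (closures zero))) ℕ.+ ∣ A zero ∪ ∅ ∣
      ≡⟨ ≡.cong₂ ℕ._+_ (≡.trans (≡.cong rank (≡.sym (proj₂ (closures zero)))) (rank-cl (D ─ A zero)))
                       (≡.cong ∣_∣ (∪-identityʳ (A zero))) ⟩
    rank (D ─ A zero) ℕ.+ ∣ A zero ∣      ≡⟨ ranks zero ⟩
    suc (rank D)                          ≡⟨ ℕ.+-comm (rank D) 1 ⟨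
    rank D ℕ.+ 1                          ∎)
  parts-rank {suc ℓ} D A disjoint A⊆D closures ranks =
    step (closures zero) (parts-rank D (A ∘ suc) (λ i j i≢j → disjoint (suc i) (suc j) (i≢j ∘ suc-injective))
                                     (A⊆D ∘ suc) (closures ∘ suc) (ranks ∘ suc))
    where
    A⁺ : EdgeSet n
    A⁺ = ⋃ (List.tabulate (A ∘ suc))

    A₀∩A⁺ : Empty (A zero ∩ A⁺)
    A₀∩A⁺ (e , e∈) with x∈p∩q⁻ (A zero) A⁺ e∈
    ... | e∈₀ , e∈⁺ with ∈⋃⁻ (A ∘ suc) e∈⁺
    ...   | i , e∈ᵢ = disjoint zero (suc i) (λ ()) (e , x∈p∩q⁺ (e∈₀ , e∈ᵢ))

    -- Disjointness puts `A zero` inside every `D ─ A (suc i)`.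
    A₀⊆⋂ : A zero ⊆ ⋂ (List.tabulate λ i → cl (D ─ A (suc i)))
    A₀⊆⋂ {e} e∈₀ = ∈⋂⁺ λ i → ⊆cl
      (x∈p∧x∉q⇒x∈p─q (A⊆D zero e∈₀) λ e∈ᵢ → disjoint zero (suc i) (λ ()) (e , x∈p∩q⁺ (e∈₀ , e∈ᵢ)))

    total : ∀ m a b r s → m ℕ.+ a ≡ suc s → s ℕ.+ b ≡ r ℕ.+ suc ℓ → m ℕ.+ (a ℕ.+ b) ≡ r ℕ.+ suc (suc ℓ)
    total m a b r s m+a s+b = ≡.trans (≡.sym (ℕ.+-assoc m a b))
      (≡.trans (≡.cong (ℕ._+ b) m+a) (≡.trans (≡.cong suc s+b) (≡.sym (ℕ.+-suc r (suc ℓ)))))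

    step : (∃ λ W₀ → cl (D ─ A zero) ≡ complete W₀) → PartsRank D (A ∘ suc) → PartsRank D A
    step (W₀ , cl≡) (W , ⋂≡ , rank-W) = W₀ ∩ W , ≡.trans (≡.cong₂ _∩_ cl≡ ⋂≡) (complete-∩ W₀ W) ,
      ≡.trans (≡.cong (rank (complete (W₀ ∩ W)) ℕ.+_) (∣p∪q∣≡∣p∣+∣q∣ (A zero) A⁺ A₀∩A⁺))
        (total (rank (complete (W₀ ∩ W))) (∣ A zero ∣) (∣ A⁺ ∣) (rank D) (rank (complete W))
          (modular-step W₀ W cl≡ (λ {e} → ≡.subst (e ∈_) ⋂≡ ∘ A₀⊆⋂)
            (≡.subst (Spans rigidityMatrix D) ⋂≡ (⋂-cl-spanned {D = D} (A ∘ suc))) (ranks zero))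
          rank-W)

  cl-fold-circuit : 1 ℕ.≤ d → ∀ {k} F → IsFoldCircuit k F → IsRigid F → ∃ λ W → cl F ≡ complete W
  cl-fold-circuit 1≤d F (cyclic , _) rigid =
    spanned F , cl-rigid 1≤d (⊆-complete-spanned F) (complete-spanned-nonempty F) cyclic rigid

  -- Stated at `suc k`, where `suc k ∸ 1` computes to `k`.
  fold-circuit-balanced : 1 ℕ.≤ d → ∀ k E → IsFoldCircuit (suc k) E →
    (∀ F → F ⊆ E → IsFoldCircuit k F → IsRigid F) → IsBalanced (suc k) E
  -- Without parts `E` would be empty, but its size is its rank plus `suc k`.
  fold-circuit-balanced 1≤d k E (_ , rank-E) rigid {zero} A partition =
    ⊥-elim (ℕ.0≢1+n (≡.trans (≡.sym (∣⊥∣≡0 ∣K n ∣))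
      (≡.trans (≡.cong ∣_∣ (IsPrincipalPartition.covers partition)) (≡.trans (≡.sym rank-E) (ℕ.+-suc (rank E) k)))))
  fold-circuit-balanced 1≤d k E (_ , rank-E) rigid {suc ℓ} A partition =
    conclude (parts-rank E A disjoint A⊆E
      (λ i → cl-fold-circuit 1≤d (E ─ A i) (proj₁ (fold i)) (rigid (E ─ A i) (proj₂ (fold i)) (proj₁ (fold i)))) ranks)
    where
    open IsPrincipalPartition partition

    fold : ∀ i → IsFoldCircuit k (E ─ A i) × E ─ A i ⊆ E
    fold i = Equivalence.from (folds (E ─ A i)) (i , ≡.refl)

    A⊆E : ∀ i → A i ⊆ E
    A⊆E i = ≡.subst (A i ⊆_) covers (∈⋃⁺ A i)

    cancel : ∀ r a r′ → r ℕ.+ k ℕ.+ a ≡ r′ ℕ.+ suc k → r ℕ.+ a ≡ suc r′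
    cancel r a r′ eq = ℕ.+-cancelʳ-≡ k _ _ (begin
      r ℕ.+ a ℕ.+ k    ≡⟨ solve 3 (λ r a k → r :+ a :+ k := r :+ k :+ a) ≡.refl r a k ⟩
      r ℕ.+ k ℕ.+ a    ≡⟨ eq ⟩
      r′ ℕ.+ suc k     ≡⟨ ℕ.+-suc r′ k ⟩
      suc r′ ℕ.+ k     ∎)

    -- `E` has nullity `suc k` and `E ─ A i` has nullity `k`; comparing sizes leaves the 1.
    ranks : ∀ i → rank (E ─ A i) ℕ.+ ∣ A i ∣ ≡ suc (rank E)
    ranks i = cancel (rank (E ─ A i)) (∣ A i ∣) (rank E) (begin
      rank (E ─ A i) ℕ.+ k ℕ.+ ∣ A i ∣    ≡⟨ ≡.cong (ℕ._+ ∣ A i ∣) (proj₂ (proj₁ (fold i))) ⟩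
      ∣ E ─ A i ∣ ℕ.+ ∣ A i ∣             ≡⟨ q⊆p⇒∣p─q∣+∣q∣ (A⊆E i) ⟩
      ∣ E ∣                               ≡⟨ rank-E ⟨
      rank E ℕ.+ suc k                    ∎)

    finish : ∀ r w a → w ℕ.+ a ≡ r ℕ.+ suc ℓ → r ℕ.+ suc k ≡ a → w ℕ.+ suc k ≡ suc ℓ
    finish r w a w+a r+k = ℕ.+-cancelˡ-≡ r _ _ (begin
      r ℕ.+ (w ℕ.+ suc k)  ≡⟨ solve 3 (λ r w k → r :+ (w :+ k) := w :+ (r :+ k)) ≡.refl r w (suc k) ⟩
      w ℕ.+ (r ℕ.+ suc k)  ≡⟨ ≡.cong (w ℕ.+_) r+k ⟩
      w ℕ.+ a              ≡⟨ w+a ⟩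
      r ℕ.+ suc ℓ          ∎)

    conclude : PartsRank E A → rank (⋂ (List.tabulate λ i → cl (E ─ A i))) ℕ.+ suc k ≡ suc ℓ
    conclude (W , ⋂≡ , rank-W) = ≡.trans (≡.cong (λ X → rank X ℕ.+ suc k) ⋂≡)
      (finish (rank E) (rank (complete W)) (∣ ⋃ (List.tabulate A) ∣) rank-W
        (≡.trans rank-E (≡.cong ∣_∣ (≡.sym covers))))

theorem3p16 : ∀ {c ℓ₁ ℓ₂ : Level} (K : HeytingField c ℓ₁ ℓ₂) (_#?_ : Decidable (HeytingField._#_ K))
    (ι : ℚ → HeytingField.Carrier K) → IsRingHomomorphism +-*-rawRing (rawRing K) ι →
    ∀ {n d : ℕ} (p : Fin n → Fin d → HeytingField.Carrier K) → Genericity.Generic K ι p →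
    let open Rigidity K _#?_ p in
    1 ≤ d → ∀ (k : ℕ) → 1 ≤ k → ∀ (E : EdgeSet n) →
    IsFoldCircuit k E →
    (∀ (F : EdgeSet n) → F ⊆ E → IsFoldCircuit (k ∸ 1) F → IsRigid F) →
    IsBalanced k E
theorem3p16 K _#?_ ι ι-hom p generic 1≤d (suc k) _ E =
  Balance.fold-circuit-balanced K _#?_ p (Specialisation.generic-independent K _#?_ ι ι-hom generic) 1≤d k E
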